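{- Assume the setting in the context, with $\delta\theta>0$. Set $A_m=\lfloor z_0/(\delta+\theta)\rfloor$ and write $z_0=\overline{z_{0,1}}\delta+\widehat{z_{0,1}}$ ($0\le\widehat{z_{0,1}}<\delta$), $z_0=\overline{z_{0,2}}\theta+\widehat{z_{0,2}}$ ($0\le\widehat{z_{0,2}}<\theta$), $\delta=\overline\delta\theta+\widehat\delta$ ($0\le\widehat\delta<\theta$), $\theta=\overline\theta\delta+\widehat\theta$ ($0\le\widehat\theta<\delta$). When $w>0$ write $x_0=\overline{x_0}w+\widehat{x_0}$, $l=\overline lw+\widehat l$ ($0\le\widehat{x_0},\widehat l<w$) and $k_0=\lceil (z_0w-x_0\theta)/b\rceil$; when $y>0$ write $y_0=\overline{y_0}y+\widehat{y_0}$, $h=\overline hy+\widehat h$ ($0\le\widehat{y_0},\widehat h<y$) and $k_1=\lceil (z_0y-y_0\delta)/a\rceil$ (then $k_0,k_1\ge0$). Define the quantities $\Sigma_1=\sum_{k=0}^{A_m}\lfloor(\widehat{z_{0,1}}-k\widehat\theta)/\delta\rfloor$, $\Sigma_2=\sum_{k=0}^{A_m}\lfloor(\widehat{z_{0,2}}-k\widehat\delta)/\theta\rfloor$, $\mathcal A_0=(1+A_m)\overline{z_{0,1}}-(\overline\theta+1)\frac{A_m(1+A_m)}2+\Sigma_1$, $\mathcal A_1=(1+A_m)\overline{z_{0,1}}+k_1(\overline{y_0}-\overline{z_{0,1}})+(\overline\theta+\overline h)\frac{(k_1-1)k_1}2-(\overline\theta+1)\frac{A_m(1+A_m)}2+\sum_{k=0}^{k_1-1}\lfloor(\widehat{y_0}+k\widehat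 h)/y\rfloor+\sum_{k=k_1}^{A_m}\lfloor(\widehat{z_{0,1}}-k\widehat\theta)/\delta\rfloor$, $\mathcal A_2=(1+A_m)\overline{y_0}+(\overline h-1)\frac{A_m(1+A_m)}2+\sum_{k=0}^{A_m}\lfloor(\widehat{y_0}+k\widehat h)/y\rfloor$, $\mathcal B_0=(1+A_m)\overline{z_{0,2}}-(\overline\delta+1)\frac{A_m(1+A_m)}2+\Sigma_2$, $\mathcal B_1=(1+A_m)\overline{z_{0,2}}+k_0(\overline{x_0}-\overline{z_{0,2}})+(\overline l+\overline\delta)\frac{(k_0-1)k_0}2-(\overline\delta+1)\frac{A_m(1+A_m)}2+\sum_{k=0}^{k_0-1}\lfloor(\widehat{x_0}+k\widehat l)/w\rfloor+\sum_{k=k_0}^{A_m}\lfloor(\widehat{z_{0,2}}-k\widehat\delta)/\theta\rfloor$, $\mathcal B_2=(1+A_m)\overline{x_0}+(\overline l-1)\frac{A_m(1+A_m)}2+\sum_{k=0}^{A_m}\lfloor(\widehat{x_0}+k\widehat l)/w\rfloor$ (each defined only when the quantities it uses are defined). Then: (iii.1) If $w=y=0$: $d(m,T)=(1+A_m)(1+\overline{z_{0,1}}+\overline{z_{0,2}})-(\overline\delta+\overline\theta+2)\frac{A_m(1+A_m)}2+\Sigma_1+\Sigma_2$. (iii.2) If $w\ne0$, $y=0$: if $k_0=0$, $d(m,T)$ is given by the formula of (iii.1); if $k_0>0$, $d(m,T)=(1+A_m)(1+\overline{z_{0,1}})-(1+\overline\theta)\frac{A_m(1+A_m)}2+\Sigma_1+\mathcal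 B$, where $\mathcal B=\mathcal B_1$ if $1\le k_0\le A_m$ and $\mathcal B=\mathcal B_2$ if $k_0>A_m$. (iii.3) If $w=0$, $y\neq 0$: if $k_1=0$, $d(m,T)$ is given by the formula of (iii.1); if $k_1>0$, $d(m,T)=(1+A_m)(1+\overline{z_{0,2}})-(\overline\delta+1)\frac{A_m(1+A_m)}2+\Sigma_2+\mathcal A$, where $\mathcal A=\mathcal A_1$ if $1\le k_1\le A_m$ and $\mathcal A=\mathcal A_2$ if $k_1>A_m$. (iii.4) If $wy\ne0$: $d(m,T)=1+A_m+\mathcal A+\mathcal B$, where $\mathcal A=\mathcal A_0,\mathcal A_1,\mathcal A_2$ according as $k_1=0$, $1\le k_1\le A_m$, $k_1>A_m$, and $\mathcal B=\mathcal B_0,\mathcal B_1,\mathcal B_2$ according as $k_0=0$, $1\le k_0\le A_m$, $k_0>A_m$.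
   Context: Let $a<b<c$ be positive integers with $\gcd(a,b,c)=1$ and $T=\langle a,b,c\rangle=\{xa+yb+zc:x,y,z\in\mathbb N\}$. For $m\in T$, the denumerant $d(m,T)$ is the number of $(x,y,z)\in\mathbb N^3$ with $xa+yb+zc=m$. For $(i,j)\in\mathbb N^2$ let $[\![i,j]\!]=[i,i+1)\times[j,j+1)\subset\mathbb R^2$. For integers $0\le w<l$, $0\le y<h$, the L-shape $\mathrm L(l,h,w,y)$ is the set of unit squares $[\![i,j]\!]$ with $0\le i<l$, $0\le j<h$, excluding those with $i\ge l-w$ and $j\ge h-y$ (it has $lh-wy$ squares). An L-shape $\mathcal H$ is related to $T$ if it consists of exactly $c$ squares, every residue class modulo $c$ equals $ia+jb \bmod c$ for exactly one $[\![i,j]\!]\in\mathcal H$, and for each $[\![i,j]\!]\in\mathcal H$, $ia+jb=\min\{sa+tb:(s,t)\in\mathbb N^2,\ sa+tb\equiv ia+jb \pmod c\}$. Setting: $\mathcal H=\mathrm L(l,h,w,y)$ is an L-shape related to $T$, and $\delta=(la-yb)/c$, $\theta=(hb-wa)/c$; it is known that $\delta,\theta$ are nonnegative integers with $\delta+\theta>0$, $a=h\delta+y\theta$, $b=w\delta+l\theta$, $lh-wy=c$. For $m\in T$, the basic factorization of $m$ with respect to $\mathcal H$ is the unique $(x_0,y_0,z_0)\in\mathbb N^3$ with $x_0a+y_0b+z_0c=m$ and $[\![x_0,y_0]\!]\in\mathcal H$. Fix $m\in T$ with basic factorization $(x_0,y_0,z_0)$. -}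

module Defs where

open import Data.Bool.Base using (if_then_else_)
open import Data.Integer.Base using (ℤ; +_; 0ℤ; 1ℤ; _+_; _-_; _*_; -_; _⊔_; ∣_∣; _/ℕ_)
open import Data.Integer.Properties using (_≟_; _≤?_)
open import Data.List.Base using (List; applyUpTo; cartesianProduct; filter; foldr; length; upTo)
open import Data.List.Membership.Propositional using (_∈_)
open import Data.List.Membership.Propositional.Properties
  using (∈-cartesianProduct⁺; ∈-filter⁺; ∈-filter⁻; ∈-upTo⁺)
open import Data.List.Relation.Unary.Unique.Propositional using (Unique)
open import Data.List.Relation.Unary.Unique.Propositional.Properties
  using (cartesianProduct⁺; filter⁺; upTo⁺)
open import Data.Nat.Base as ℕ using (ℕ; NonZero; _∸_; _%_; _≤_; s≤s)
import Data.Nat.Properties as ℕ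
open import Data.Product using (_×_; _,_; ∃; ∃!; proj₂)
open import Function.Bundles using (_⇔_; mk⇔)
open import Level using (0ℓ)
open import Relation.Binary.PropositionalEquality using (_≡_)
open import Relation.Nullary using (¬?; does; _×-dec_)
open import Relation.Unary using (Decidable; Pred)

IsFactorization : (a b c m : ℕ) → Pred (ℕ × ℕ × ℕ) 0ℓ
IsFactorization a b c m (x , y , z) = x ℕ.* a ℕ.+ y ℕ.* b ℕ.+ z ℕ.* c ≡ m

isFactorization? : ∀ a b c m → Decidable (IsFactorization a b c m)
isFactorization? a b c m (x , y , z) = x ℕ.* a ℕ.+ y ℕ.* b ℕ.+ z ℕ.* c ℕ.≟ m

⟨_,_,_⟩ : (a b c : ℕ) → Pred ℕ 0ℓ
⟨ a , b , c ⟩ m = ∃ (IsFactorization a b c m)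

triplesUpTo : ℕ → List (ℕ × ℕ × ℕ)
triplesUpTo m = cartesianProduct ns (cartesianProduct ns ns)
  where ns = upTo (ℕ.suc m)

-- For positive generators every coordinate of a factorization of m is at most
-- m, so this search finds all of them, each once: see ∈-factorizations and
-- factorizations-unique.
factorizations : (a b c m : ℕ) → List (ℕ × ℕ × ℕ)
factorizations a b c m = filter (isFactorization? a b c m) (triplesUpTo m)

denumerant : (a b c m : ℕ) → ℕ
denumerant a b c m = length (factorizations a b c m)

∈-factorizations : ∀ a b c .{{_ : NonZero a}} .{{_ : NonZero b}} .{{_ : NonZero c}} m xyz →
  xyz ∈ factorizations a b c m ⇔ IsFactorization a b c m xyz
∈-factorizations a b c m (x , y , z) = mk⇔ from-list to-list
  where
  from-list : (x , y , z) ∈ factorizations a b c m → IsFactorization a b c m (x , y , z)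
  from-list p = proj₂ (∈-filter⁻ (isFactorization? a b c m) {xs = triplesUpTo m} p)
  to-list : IsFactorization a b c m (x , y , z) → (x , y , z) ∈ factorizations a b c m
  to-list eq = ∈-filter⁺ (isFactorization? a b c m)
    (∈-cartesianProduct⁺ (bound x≤) (∈-cartesianProduct⁺ (bound y≤) (bound z≤))) eq
    where
    bound : ∀ {n} → n ≤ x ℕ.* a ℕ.+ y ℕ.* b ℕ.+ z ℕ.* c → n ∈ upTo (ℕ.suc m)
    bound n≤ = ∈-upTo⁺ (s≤s (ℕ.≤-trans n≤ (ℕ.≤-reflexive eq)))
    xa+yb≤ = ℕ.m≤m+n (x ℕ.* a ℕ.+ y ℕ.* b) (z ℕ.* c)
    x≤ = ℕ.≤-trans (ℕ.m≤m*n x a) (ℕ.≤-trans (ℕ.m≤m+n (x ℕ.* a) (y ℕ.* b)) xa+yb≤)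
    y≤ = ℕ.≤-trans (ℕ.m≤m*n y b) (ℕ.≤-trans (ℕ.m≤n+m (y ℕ.* b) (x ℕ.* a)) xa+yb≤)
    z≤ = ℕ.≤-trans (ℕ.m≤m*n z c) (ℕ.m≤n+m (z ℕ.* c) (x ℕ.* a ℕ.+ y ℕ.* b))

factorizations-unique : ∀ a b c m → Unique (factorizations a b c m)
factorizations-unique a b c m = filter⁺ (isFactorization? a b c m)
  (cartesianProduct⁺ ns! (cartesianProduct⁺ ns! ns!))
  where ns! = upTo⁺ (ℕ.suc m)

-- A unit square is represented by its lower left corner (i , j).
LShape : (l h w y : ℕ) → List (ℕ × ℕ)
LShape l h w y =
  filter (λ (i , j) → ¬? ((l ∸ w ℕ.≤? i) ×-dec (h ∸ y ℕ.≤? j)))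
    (cartesianProduct (upTo l) (upTo h))

record IsRelated (a b c : ℕ) .{{_ : NonZero c}} (H : List (ℕ × ℕ)) : Set where
  field
    size     : length H ≡ c
    residues : ∀ n → ∃! _≡_ λ ((i , j) : ℕ × ℕ) →
                 (i , j) ∈ H × (i ℕ.* a ℕ.+ j ℕ.* b) % c ≡ n % c
    minimal  : ∀ i j → (i , j) ∈ H →
                 ∀ s t → (s ℕ.* a ℕ.+ t ℕ.* b) % c ≡ (i ℕ.* a ℕ.+ j ℕ.* b) % c →
                 i ℕ.* a ℕ.+ j ℕ.* b ≤ s ℕ.* a ℕ.+ t ℕ.* b

record IsBasicFactorization (a b c : ℕ) (H : List (ℕ × ℕ)) (m x₀ y₀ z₀ : ℕ) : Set where
  field
    factorization : IsFactorization a b c m (x₀ , y₀ , z₀)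
    basic         : (x₀ , y₀) ∈ H

-- _/ℕ_ rounds towards -∞, also for negative numerators.
⌊_/_⌋ : ℤ → (n : ℕ) .{{_ : NonZero n}} → ℤ
⌊ p / n ⌋ = p /ℕ n

⌈_/_⌉ : ℤ → (n : ℕ) .{{_ : NonZero n}} → ℤ
⌈ p / n ⌉ = - ⌊ - p / n ⌋

-- The sum of f k over all integers p ≤ k ≤ q; it is 0 when q < p.
∑[_⋯_] : ℤ → ℤ → (ℤ → ℤ) → ℤ
∑[ p ⋯ q ] f = foldr _+_ 0ℤ (applyUpTo (λ n → f (p + + n)) ∣ 0ℤ ⊔ (1ℤ + q - p) ∣)

module Formulas (a b : ℕ) .{{_ : NonZero a}} .{{_ : NonZero b}} (l h w y : ℕ)
                (δ θ : ℕ) .{{_ : NonZero δ}} .{{_ : NonZero θ}} (x₀ y₀ z₀ : ℕ) where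

  private
    δ+θ-nonZero : NonZero (δ ℕ.+ θ)
    δ+θ-nonZero = ℕ.>-nonZero (ℕ.<-≤-trans (ℕ.>-nonZero⁻¹ δ) (ℕ.m≤m+n δ θ))

  Aₘ : ℤ
  Aₘ = + ((z₀ ℕ./ (δ ℕ.+ θ)) {{δ+θ-nonZero}})

  -- For n = δ, θ, w, y the names ⌊u/n⌋ and u%n stand for the quotient ū and
  -- the remainder û of u by n.
  ⌊z₀/δ⌋ z₀%δ ⌊z₀/θ⌋ z₀%θ ⌊δ/θ⌋ δ%θ ⌊θ/δ⌋ θ%δ : ℤ
  ⌊z₀/δ⌋ = + (z₀ ℕ./ δ)
  z₀%δ   = + (z₀ ℕ.% δ)
  ⌊z₀/θ⌋ = + (z₀ ℕ./ θ)
  z₀%θ   = + (z₀ ℕ.% θ)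
  ⌊δ/θ⌋  = + (δ ℕ./ θ)
  δ%θ    = + (δ ℕ.% θ)
  ⌊θ/δ⌋  = + (θ ℕ./ δ)
  θ%δ    = + (θ ℕ.% δ)

  k₀ k₁ : ℤ
  k₀ = ⌈ + z₀ * + w - + x₀ * + θ / b ⌉
  k₁ = ⌈ + z₀ * + y - + y₀ * + δ / a ⌉

  Σ₁ Σ₂ : ℤ
  Σ₁ = ∑[ 0ℤ ⋯ Aₘ ] λ k → ⌊ z₀%δ - k * θ%δ / δ ⌋
  Σ₂ = ∑[ 0ℤ ⋯ Aₘ ] λ k → ⌊ z₀%θ - k * δ%θ / θ ⌋

  𝓐₀ 𝓑₀ : ℤ
  𝓐₀ = (1ℤ + Aₘ) * ⌊z₀/δ⌋ - (⌊θ/δ⌋ + 1ℤ) * ⌊ Aₘ * (1ℤ + Aₘ) / 2 ⌋ + Σ₁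
  𝓑₀ = (1ℤ + Aₘ) * ⌊z₀/θ⌋ - (⌊δ/θ⌋ + 1ℤ) * ⌊ Aₘ * (1ℤ + Aₘ) / 2 ⌋ + Σ₂

  module _ .{{_ : NonZero y}} where

    ⌊y₀/y⌋ y₀%y ⌊h/y⌋ h%y : ℤ
    ⌊y₀/y⌋ = + (y₀ ℕ./ y)
    y₀%y   = + (y₀ ℕ.% y)
    ⌊h/y⌋  = + (h ℕ./ y)
    h%y    = + (h ℕ.% y)

    𝓐₁ 𝓐₂ 𝓐 : ℤ
    𝓐₁ = (1ℤ + Aₘ) * ⌊z₀/δ⌋ + k₁ * (⌊y₀/y⌋ - ⌊z₀/δ⌋)
       + (⌊θ/δ⌋ + ⌊h/y⌋) * ⌊ (k₁ - 1ℤ) * k₁ / 2 ⌋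
       - (⌊θ/δ⌋ + 1ℤ) * ⌊ Aₘ * (1ℤ + Aₘ) / 2 ⌋
       + (∑[ 0ℤ ⋯ k₁ - 1ℤ ] λ k → ⌊ y₀%y + k * h%y / y ⌋)
       + (∑[ k₁ ⋯ Aₘ ] λ k → ⌊ z₀%δ - k * θ%δ / δ ⌋)
    𝓐₂ = (1ℤ + Aₘ) * ⌊y₀/y⌋ + (⌊h/y⌋ - 1ℤ) * ⌊ Aₘ * (1ℤ + Aₘ) / 2 ⌋
       + (∑[ 0ℤ ⋯ Aₘ ] λ k → ⌊ y₀%y + k * h%y / y ⌋)
    𝓐 = if does (k₁ ≟ 0ℤ) then 𝓐₀ else if does (k₁ ≤? Aₘ) then 𝓐₁ else 𝓐₂

  module _ .{{_ : NonZero w}} where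

    ⌊x₀/w⌋ x₀%w ⌊l/w⌋ l%w : ℤ
    ⌊x₀/w⌋ = + (x₀ ℕ./ w)
    x₀%w   = + (x₀ ℕ.% w)
    ⌊l/w⌋  = + (l ℕ./ w)
    l%w    = + (l ℕ.% w)

    𝓑₁ 𝓑₂ 𝓑 : ℤ
    𝓑₁ = (1ℤ + Aₘ) * ⌊z₀/θ⌋ + k₀ * (⌊x₀/w⌋ - ⌊z₀/θ⌋)
       + (⌊l/w⌋ + ⌊δ/θ⌋) * ⌊ (k₀ - 1ℤ) * k₀ / 2 ⌋
       - (⌊δ/θ⌋ + 1ℤ) * ⌊ Aₘ * (1ℤ + Aₘ) / 2 ⌋
       + (∑[ 0ℤ ⋯ k₀ - 1ℤ ] λ k → ⌊ x₀%w + k * l%w / w ⌋)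
       + (∑[ k₀ ⋯ Aₘ ] λ k → ⌊ z₀%θ - k * δ%θ / θ ⌋)
    𝓑₂ = (1ℤ + Aₘ) * ⌊x₀/w⌋ + (⌊l/w⌋ - 1ℤ) * ⌊ Aₘ * (1ℤ + Aₘ) / 2 ⌋
       + (∑[ 0ℤ ⋯ Aₘ ] λ k → ⌊ x₀%w + k * l%w / w ⌋)
    𝓑 = if does (k₀ ≟ 0ℤ) then 𝓑₀ else if does (k₀ ≤? Aₘ) then 𝓑₁ else 𝓑₂

{-# OPTIONS --safe #-}

-- From any (x , y) ∈ ℕ² one reaches the L-shape by repeatedly subtracting (l , - y),
-- (- w , h) or their sum, which keeps x a + y b fixed modulo c; the end point is
-- (x₀ , y₀) as residues are unique in the L-shape.  So every factorization of m is
--   (x₀ + p l - q w , y₀ + q h - p y , z₀ - p δ - q θ)   with p, q ∈ ℕ,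
-- for exactly one (p , q) because l h - w y = c ≠ 0, and d(m,T) is the number of
-- (p , q) for which these three numbers are nonnegative.  Sort these pairs by
-- k = min p q.  The diagonal pairs are those with k ≤ Aₘ.  For p > q = k only the last
-- two constraints matter and bound p by ⌊(y₀ + k h)/y⌋ and ⌊(z₀ - k θ)/δ⌋; since
-- a = h δ + y θ, the first bound is the smaller one as long as k < k₁ and the second
-- one from then on, whence 𝓐.  The pairs with q > p give 𝓑 in the same way.
module Submission where

open import Defs
open import Data.Bool.Base using (if_then_else_)
open import Data.Integer.Base as ℤ using (ℤ; +_; 0ℤ; 1ℤ; -1ℤ; _+_; _-_; _*_; -_; _⊔_; ∣_∣; _≤_; _<_; +≤+; +<+)
open import Data.Integer.DivMod using ([n/ℕd]*d≤n; n<s[n/ℕd]*d)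
open import Data.Integer.Properties
open import Data.Integer.Tactic.RingSolver using (solve-∀)
open import Data.List.Base
  using (List; []; _∷_; _++_; applyUpTo; cartesianProduct; concat; foldr; length; map; upTo)
open import Data.List.Membership.Propositional using () renaming (_∈_ to _∈ˡ_)
open import Data.List.Membership.Propositional.Properties
open import Data.List.Membership.Propositional.Properties.WithK using (unique∧set⇒bag)
open import Data.List.Properties using (length-++; length-applyUpTo; length-map)
open import Data.List.Relation.Binary.BagAndSetEquality using (∼bag⇒↭)
open import Data.List.Relation.Binary.Permutation.Propositional.Properties using (↭-length)
import Data.List.Relation.Unary.All.Properties as All
import Data.List.Relation.Unary.AllPairs.Properties as AllPairs
open import Data.List.Relation.Unary.Unique.Propositional using (Unique)
import Data.List.Relation.Unary.Unique.Propositional.Properties as Unique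
open import Data.Nat.Base as ℕ using (ℕ; NonZero; zero; suc; _%_; _∸_)
import Data.Nat.DivMod as ℕ
open import Data.Nat.GCD using (gcd)
import Data.Nat.Properties as ℕ
import Data.Nat.Tactic.RingSolver as ℕ-Solver
open import Data.Product using (_×_; _,_; proj₁; proj₂; ∃; ∃₂; swap; uncurry)
open import Data.Sum.Base using (inj₁; inj₂)
open import Function.Base using (_∘_; id)
open import Function.Bundles using (_⇔_; mk⇔; Equivalence)
open import Function.Properties.Equivalence using () renaming (trans to ⇔-trans)
open import Relation.Binary.PropositionalEquality
open import Relation.Nullary using (¬_; Dec; yes; no; does; contradiction; _×-dec_; ¬?)
open import Relation.Nullary.Decidable using (dec-true; dec-false)
open import Relation.Unary using (_∈_)

-- Comparing lists without repetitions

-- Without repetitions, equality as sets is equality as bags, which makes the lists permutations of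
-- each other. The area of the L-shape and the denumerant are both computed this way.
length-unique : {A : Set} {xs ys : List A} → Unique xs → Unique ys →
  (∀ {v} → v ∈ˡ xs → v ∈ˡ ys) → (∀ {v} → v ∈ˡ ys → v ∈ˡ xs) → length xs ≡ length ys
length-unique xs! ys! xs⊆ys ys⊆xs =
  ↭-length (∼bag⇒↭ (unique∧set⇒bag xs! ys! (mk⇔ xs⊆ys ys⊆xs)))

length-cartesianProduct : {A B : Set} (xs : List A) (ys : List B) →
  length (cartesianProduct xs ys) ≡ length xs ℕ.* length ys
length-cartesianProduct []       ys = refl
length-cartesianProduct (x ∷ xs) ys =
  trans (length-++ (map (x ,_) ys))
        (cong₂ ℕ._+_ (length-map (x ,_) ys) (length-cartesianProduct xs ys))

-- Staircases of pairs and their size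

sumBelow : ℕ → (ℕ → ℤ) → ℤ
sumBelow n f = foldr _+_ 0ℤ (applyUpTo f n)

-- The `suc` keeps the diagonal out: row `k` consists of the `(p , k)` with `k < p ≤ k + α k`.
row : (ℕ → ℕ) → ℕ → List (ℕ × ℕ)
row α k = applyUpTo (λ j → suc (k ℕ.+ j) , k) (α k)

below : (ℕ → ℕ) → ℕ → List (ℕ × ℕ)
below α n = concat (applyUpTo (row α) n)

∈-below⁺ : ∀ α {n k j} → k ℕ.< n → j ℕ.< α k → (suc (k ℕ.+ j) , k) ∈ˡ below α n
∈-below⁺ α {k = k} k<n j<αk = ∈-concat⁺′ (∈-applyUpTo⁺ (λ j → suc (k ℕ.+ j) , k) j<αk) (∈-applyUpTo⁺ (row α) k<n)

∈-below⁻ : ∀ α n {v} → v ∈ˡ below α n →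
  ∃₂ λ k j → k ℕ.< n × j ℕ.< α k × v ≡ (suc (k ℕ.+ j) , k)
∈-below⁻ α n v∈ with ∈-concat⁻′ (applyUpTo (row α) n) v∈
... | _ , v∈row , row∈ with ∈-applyUpTo⁻ (row α) row∈
... | k , k<n , refl with ∈-applyUpTo⁻ (λ j → suc (k ℕ.+ j) , k) v∈row
... | j , j<αk , eq = k , j , k<n , j<αk , eq

below-unique : ∀ α n → Unique (below α n)
below-unique α n = Unique.concat⁺
  (All.applyUpTo⁺₂ _ n λ k → Unique.applyUpTo⁺₁ _ (α k) λ i<j _ eq →
    ℕ.<⇒≢ i<j (ℕ.+-cancelˡ-≡ k _ _ (ℕ.suc-injective (cong proj₁ eq))))
  (AllPairs.applyUpTo⁺₁ _ n λ i<j _ (v∈i , v∈j) → ℕ.<⇒≢ i<j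
    (trans (sym (cong proj₂ (proj₂ (proj₂ (∈-applyUpTo⁻ _ v∈i)))))
           (cong proj₂ (proj₂ (proj₂ (∈-applyUpTo⁻ _ v∈j))))))

length-concat-applyUpTo : {A : Set} (f : ℕ → List A) (n : ℕ) →
  + length (concat (applyUpTo f n)) ≡ sumBelow n (λ k → + length (f k))
length-concat-applyUpTo f zero    = refl
length-concat-applyUpTo f (suc n) =
  trans (cong +_ (length-++ (f 0))) (cong (λ s → + length (f 0) + s) (length-concat-applyUpTo (f ∘ suc) n))

sumBelow-cong : ∀ n {f g : ℕ → ℤ} → (∀ {k} → k ℕ.< n → f k ≡ g k) → sumBelow n f ≡ sumBelow n g
sumBelow-cong zero    eq = refl
sumBelow-cong (suc n) eq = cong₂ _+_ (eq (ℕ.s≤s ℕ.z≤n)) (sumBelow-cong n (eq ∘ ℕ.s≤s))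

length-below : ∀ α n → + length (below α n) ≡ sumBelow n (λ k → + α k)
length-below α n = trans (length-concat-applyUpTo _ n)
  (sumBelow-cong n λ {k} _ → cong +_ (length-applyUpTo _ (α k)))

-- Splits a set of pairs (p , q) into the diagonal and the two sides of it,
-- each side cut into rows by the value k of min p q.
staircase : (α β : ℕ → ℕ) → ℕ → List (ℕ × ℕ)
staircase α β n = applyUpTo (λ k → k , k) n ++ below α n ++ map swap (below β n)

-- The form `suc (k + j)` of the larger coordinate is the one produced by `ℕ.compare`, which sorts
-- an arbitrary pair into one of the three fields.
record IsStaircase (D : ℕ → ℕ → Set) (n : ℕ) (α β : ℕ → ℕ) : Set where
  field
    diagonal : ∀ k → D k k ⇔ k ℕ.< n
    lower    : ∀ k j → D (suc (k ℕ.+ j)) k ⇔ (k ℕ.< n × j ℕ.< α k)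
    upper    : ∀ k j → D k (suc (k ℕ.+ j)) ⇔ (k ℕ.< n × j ℕ.< β k)

length-staircase : ∀ α β n → + length (staircase α β n) ≡
  + n + sumBelow n (λ k → + α k) + sumBelow n (λ k → + β k)
length-staircase α β n = begin
  + length (staircase α β n)
    ≡⟨ cong +_ (trans (length-++ (applyUpTo (λ k → k , k) n))
        (cong₂ ℕ._+_ (length-applyUpTo _ n) (trans (length-++ (below α n))
          (cong (length (below α n) ℕ.+_) (length-map swap (below β n)))))) ⟩
  + n + (+ length (below α n) + + length (below β n))
    ≡⟨ +-assoc (+ n) (+ length (below α n)) (+ length (below β n)) ⟨
  + n + + length (below α n) + + length (below β n)
    ≡⟨ cong₂ (λ s t → + n + s + t) (length-below α n) (length-below β n) ⟩
  + n + sumBelow n (λ k → + α k) + sumBelow n (λ k → + β k) ∎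
  where open ≡-Reasoning

∈-below⇒> : ∀ α n {p q} → (p , q) ∈ˡ below α n → q ℕ.< p
∈-below⇒> α n v∈ with ∈-below⁻ α n v∈
... | k , j , _ , _ , refl = ℕ.s≤s (ℕ.m≤m+n k j)

∈-above⇒< : ∀ β n {p q} → (p , q) ∈ˡ map swap (below β n) → p ℕ.< q
∈-above⇒< β n v∈ with ∈-map⁻ swap v∈
... | _ , u∈ , refl = ∈-below⇒> β n u∈

-- The three pieces are disjoint because `p = q`, `q < p` and `p < q` exclude each other.
staircase-unique : ∀ α β n → Unique (staircase α β n)
staircase-unique α β n = Unique.++⁺
  (Unique.applyUpTo⁺₁ _ n λ i<j _ → ℕ.<⇒≢ i<j ∘ cong proj₁)
  (Unique.++⁺ (below-unique α n) (Unique.map⁺ (cong swap) (below-unique β n))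
    λ (v∈l , v∈u) → ℕ.<-asym (∈-below⇒> α n v∈l) (∈-above⇒< β n v∈u))
  off-diagonal
  where
  off-diagonal : ∀ {v} →
    ¬ (v ∈ˡ applyUpTo (λ k → k , k) n × v ∈ˡ below α n ++ map swap (below β n))
  off-diagonal (v∈d , v∈) with ∈-applyUpTo⁻ _ v∈d
  ... | _ , _ , refl with ∈-++⁻ (below α n) v∈
  ...   | inj₁ v∈l = ℕ.<-irrefl refl (∈-below⇒> α n v∈l)
  ...   | inj₂ v∈u = ℕ.<-irrefl refl (∈-above⇒< β n v∈u)

module _ {D n α β} (D-staircase : IsStaircase D n α β) where
  open IsStaircase D-staircase
  open Equivalence

  ∈-staircase⁺ : ∀ p q → D p q → (p , q) ∈ˡ staircase α β n
  ∈-staircase⁺ p q d with ℕ.compare p q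
  ... | ℕ.equal k     = ∈-++⁺ˡ (∈-applyUpTo⁺ _ (to (diagonal k) d))
  ... | ℕ.less k j    with to (upper k j) d
  ...   | k<n , j<β   = ∈-++⁺ʳ (applyUpTo _ n) (∈-++⁺ʳ (below α n) (∈-map⁺ swap (∈-below⁺ β k<n j<β)))
  ∈-staircase⁺ p q d | ℕ.greater k j with to (lower k j) d
  ...   | k<n , j<α   = ∈-++⁺ʳ (applyUpTo _ n) (∈-++⁺ˡ (∈-below⁺ α k<n j<α))

  ∈-staircase⁻ : ∀ {p q} → (p , q) ∈ˡ staircase α β n → D p q
  ∈-staircase⁻ v∈ with ∈-++⁻ (applyUpTo (λ k → k , k) n) v∈
  ... | inj₁ v∈d with ∈-applyUpTo⁻ _ v∈d
  ...   | k , k<n , refl = from (diagonal k) k<n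
  ∈-staircase⁻ v∈ | inj₂ v∈s with ∈-++⁻ (below α n) v∈s
  ...   | inj₁ v∈l with ∈-below⁻ α n v∈l
  ...     | k , j , k<n , j<α , refl = from (lower k j) (k<n , j<α)
  ∈-staircase⁻ v∈ | inj₂ v∈s | inj₂ v∈u with ∈-map⁻ swap v∈u
  ...     | _ , u∈ , refl with ∈-below⁻ β n u∈
  ...       | k , j , k<n , j<β , refl = from (upper k j) (k<n , j<β)

-- The area of an L-shape

-- Translating by (l ∸ w , h ∸ y) puts the w × y rectangle into the missing corner.
length-LShape : ∀ l h w y → w ℕ.≤ l → y ℕ.≤ h →
  length (LShape l h w y) ℕ.+ w ℕ.* y ≡ l ℕ.* h
length-LShape l h w y w≤l y≤h = begin
  length L ℕ.+ w ℕ.* y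
    ≡⟨ cong (length L ℕ.+_) (trans (length-map shift (cartesianProduct (upTo w) (upTo y))) (length-rectangle w y)) ⟨
  length L ℕ.+ length corner
    ≡⟨ length-++ L ⟨
  length (L ++ corner)
    ≡⟨ length-unique L++corner! (rectangle-unique l h) L++corner⊆ ⊆L++corner ⟩
  length (cartesianProduct (upTo l) (upTo h))
    ≡⟨ length-rectangle l h ⟩
  l ℕ.* h ∎
  where
  open ≡-Reasoning
  L = LShape l h w y
  shift : ℕ × ℕ → ℕ × ℕ
  shift (i , j) = l ℕ.∸ w ℕ.+ i , h ℕ.∸ y ℕ.+ j
  corner = map shift (cartesianProduct (upTo w) (upTo y))
  length-rectangle : ∀ m n → length (cartesianProduct (upTo m) (upTo n)) ≡ m ℕ.* n
  length-rectangle m n = trans (length-cartesianProduct (upTo m) (upTo n))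
    (cong₂ ℕ._*_ (length-applyUpTo id m) (length-applyUpTo id n))
  rectangle-unique : ∀ m n → Unique (cartesianProduct (upTo m) (upTo n))
  rectangle-unique m n = Unique.cartesianProduct⁺ (Unique.upTo⁺ m) (Unique.upTo⁺ n)
  InCorner : ℕ × ℕ → Set
  InCorner (i , j) = l ℕ.∸ w ℕ.≤ i × h ℕ.∸ y ℕ.≤ j
  inCorner? : ∀ u → Dec (InCorner u)
  inCorner? (i , j) = (l ℕ.∸ w ℕ.≤? i) ×-dec (h ℕ.∸ y ℕ.≤? j)
  shift-injective : ∀ {u v} → shift u ≡ shift v → u ≡ v
  shift-injective eq = cong₂ _,_ (ℕ.+-cancelˡ-≡ (l ℕ.∸ w) _ _ (cong proj₁ eq))
                                 (ℕ.+-cancelˡ-≡ (h ℕ.∸ y) _ _ (cong proj₂ eq))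
  L++corner! : Unique (L ++ corner)
  L++corner! = Unique.++⁺ (Unique.filter⁺ (¬? ∘ inCorner?) (rectangle-unique l h))
    (Unique.map⁺ shift-injective (rectangle-unique w y)) disjoint
    where
    disjoint : ∀ {v} → ¬ (v ∈ˡ L × v ∈ˡ corner)
    disjoint (v∈L , v∈c) with ∈-map⁻ shift v∈c
    ... | _ , _ , refl =
      proj₂ (∈-filter⁻ (¬? ∘ inCorner?) {xs = cartesianProduct (upTo l) (upTo h)} v∈L)
        (ℕ.m≤m+n _ _ , ℕ.m≤m+n _ _)
  L++corner⊆ : ∀ {v} → v ∈ˡ L ++ corner → v ∈ˡ cartesianProduct (upTo l) (upTo h)
  L++corner⊆ v∈ with ∈-++⁻ L v∈
  ... | inj₁ v∈L = proj₁ (∈-filter⁻ (¬? ∘ inCorner?) v∈L)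
  ... | inj₂ v∈c with ∈-map⁻ shift v∈c
  ...   | (i , j) , u∈ , refl with ∈-cartesianProduct⁻ (upTo w) (upTo y) u∈
  ...     | i∈ , j∈ = ∈-cartesianProduct⁺ (bound w≤l i∈) (bound y≤h j∈)
    where
    bound : ∀ {m n i} → m ℕ.≤ n → i ∈ˡ upTo m → n ℕ.∸ m ℕ.+ i ∈ˡ upTo n
    bound {m} {n} m≤n i∈ = ∈-upTo⁺ (ℕ.<-≤-trans (ℕ.+-monoʳ-< (n ℕ.∸ m) (∈-upTo⁻ i∈))
      (ℕ.≤-reflexive (ℕ.m∸n+n≡m m≤n)))
  ⊆L++corner : ∀ {v} → v ∈ˡ cartesianProduct (upTo l) (upTo h) → v ∈ˡ L ++ corner
  ⊆L++corner {i , j} v∈ with inCorner? (i , j)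
  ... | no ∉c = ∈-++⁺ˡ (∈-filter⁺ (¬? ∘ inCorner?) v∈ ∉c)
  ... | yes (≤i , ≤j) with ∈-cartesianProduct⁻ (upTo l) (upTo h) v∈
  ...   | i∈ , j∈ = ∈-++⁺ʳ L (subst (_∈ˡ corner)
      (cong₂ _,_ (ℕ.m+[n∸m]≡n ≤i) (ℕ.m+[n∸m]≡n ≤j))
      (∈-map⁺ shift (∈-cartesianProduct⁺ (bound w≤l ≤i i∈) (bound y≤h ≤j j∈))))
    where
    bound : ∀ {m n i} → m ℕ.≤ n → n ℕ.∸ m ℕ.≤ i → i ∈ˡ upTo n → i ℕ.∸ (n ℕ.∸ m) ∈ˡ upTo m
    bound {m} {n} {i} m≤n ≤i i∈ = ∈-upTo⁺ (ℕ.+-cancelʳ-< (n ℕ.∸ m) _ _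
      (subst₂ ℕ._<_ (sym (ℕ.m∸n+n≡m ≤i)) (sym (ℕ.m+[n∸m]≡n m≤n)) (∈-upTo⁻ i∈)))

-- Floors, ceilings and finite sums

nonNeg : ∀ n → 0ℤ ≤ + n
nonNeg n = +≤+ ℕ.z≤n

positive : ∀ n .{{_ : NonZero n}} → 0ℤ < + n
positive n = +<+ (ℕ.>-nonZero⁻¹ n)

*-nonNeg : ∀ m n → 0ℤ ≤ + m * + n
*-nonNeg m n = subst (0ℤ ≤_) (pos-* m n) (nonNeg (m ℕ.* n))

-- The Galois connection between multiplication by `n` and the floor. It turns the upper bounds on
-- `p` in each row into floors.
*n≤⇔≤⌊/n⌋ : ∀ j p n .{{_ : NonZero n}} → j * + n ≤ p ⇔ j ≤ ⌊ p / n ⌋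
*n≤⇔≤⌊/n⌋ j p n = mk⇔ to from
  where
  to : j * + n ≤ p → j ≤ ⌊ p / n ⌋
  to jn≤p = subst (j ≤_) (pred-suc ⌊ p / n ⌋)
    (i<j⇒i≤pred[j] (*-cancelʳ-<-nonNeg {j} {1ℤ + ⌊ p / n ⌋} (+ n) (≤-<-trans jn≤p (n<s[n/ℕd]*d p n))))
  from : j ≤ ⌊ p / n ⌋ → j * + n ≤ p
  from j≤ = ≤-trans (*-monoʳ-≤-nonNeg (+ n) j≤) ([n/ℕd]*d≤n p n)

-- The contrapositive of the previous equivalence at `- j` and `- p`, as the ceiling is a negated
-- floor.
*n<⇔<⌈/n⌉ : ∀ j p n .{{_ : NonZero n}} → j * + n < p ⇔ j < ⌈ p / n ⌉
*n<⇔<⌈/n⌉ j p n = mk⇔ to from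
  where
  module G = Equivalence (*n≤⇔≤⌊/n⌋ (- j) (- p) n)
  to : j * + n < p → j < ⌈ p / n ⌉
  to jn<p = ≰⇒> λ ⌈⌉≤j → <⇒≱ jn<p (neg-cancel-≤ (subst (_≤ - p) (sym (neg-distribˡ-* j (+ n)))
    (G.from (subst (- j ≤_) (neg-involutive _) (neg-mono-≤ ⌈⌉≤j)))))
  from : j < ⌈ p / n ⌉ → j * + n < p
  from j<⌈⌉ = ≰⇒> λ p≤jn → <⇒≱ j<⌈⌉ (subst (⌈ p / n ⌉ ≤_) (neg-involutive j)
    (neg-mono-≤ (G.to (subst (_≤ - p) (neg-distribˡ-* j (+ n)) (neg-mono-≤ p≤jn)))))

⌊i+jn/n⌋≡⌊i/n⌋+j : ∀ i j n .{{_ : NonZero n}} → ⌊ i + j * + n / n ⌋ ≡ ⌊ i / n ⌋ + j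
⌊i+jn/n⌋≡⌊i/n⌋+j i j n = ≤-antisym
  (subst₂ _≤_ (back ⌊ i + j * + n / n ⌋ j) refl
    (+-monoˡ-≤ j (to (*n≤⇔≤⌊/n⌋ (⌊ i + j * + n / n ⌋ - j) i n)
      (subst₂ _≤_ (sym (distrib ⌊ i + j * + n / n ⌋ j (+ n))) (cancel i (j * + n))
        (+-monoˡ-≤ (- (j * + n)) ([n/ℕd]*d≤n (i + j * + n) n))))))
  (to (*n≤⇔≤⌊/n⌋ (⌊ i / n ⌋ + j) _ n) (subst (_≤ i + j * + n) (sym (*-distribʳ-+ (+ n) ⌊ i / n ⌋ j))
    (+-monoˡ-≤ (j * + n) ([n/ℕd]*d≤n i n))))
  where
  open Equivalence
  back : ∀ u v → u - v + v ≡ u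
  back = solve-∀
  cancel : ∀ u v → u + v - v ≡ u
  cancel = solve-∀
  distrib : ∀ u v m → (u - v) * m ≡ u * m - v * m
  distrib = solve-∀

⌊in/n⌋≡i : ∀ i n .{{_ : NonZero n}} → ⌊ i * + n / n ⌋ ≡ i
⌊in/n⌋≡i i n = begin
  ⌊ i * + n / n ⌋         ≡⟨ cong ⌊_/ n ⌋ (+-identityˡ (i * + n)) ⟨
  ⌊ 0ℤ + i * + n / n ⌋    ≡⟨ ⌊i+jn/n⌋≡⌊i/n⌋+j 0ℤ i n ⟩
  + (0 ℕ./ n) + i         ≡⟨ cong (λ u → + u + i) (ℕ.0/n≡0 n) ⟩
  0ℤ + i                  ≡⟨ +-identityˡ i ⟩
  i                       ∎
  where open ≡-Reasoning

pos-%-/ : ∀ m n .{{_ : NonZero n}} → + m ≡ + (m ℕ.% n) + + (m ℕ./ n) * + n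
pos-%-/ m n = trans (cong +_ (ℕ.m≡m%n+[m/n]*n m n)) (cong (_+_ (+ (m ℕ.% n))) (pos-* (m ℕ./ n) n))

-- Splitting `u` and `v` into remainder and quotient leaves a multiple of `n` that can be taken out
-- of the floor; the floor that remains is a summand of the sums in the formulas. An integer `k`
-- lets the version with a minus sign follow from `- k`.
⌊affine/n⌋ : ∀ u k v n .{{_ : NonZero n}} → ⌊ + u + k * + v / n ⌋ ≡
  + (u ℕ./ n) + k * + (v ℕ./ n) + ⌊ + (u ℕ.% n) + k * + (v ℕ.% n) / n ⌋
⌊affine/n⌋ u k v n = begin
  ⌊ + u + k * + v / n ⌋
    ≡⟨ cong ⌊_/ n ⌋ (trans (cong₂ (λ s t → s + k * t) (pos-%-/ u n) (pos-%-/ v n))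
        (regroup (+ (u ℕ.% n)) (+ (u ℕ./ n)) k (+ (v ℕ.% n)) (+ (v ℕ./ n)) (+ n))) ⟩
  ⌊ (+ (u ℕ.% n) + k * + (v ℕ.% n)) + (+ (u ℕ./ n) + k * + (v ℕ./ n)) * + n / n ⌋
    ≡⟨ ⌊i+jn/n⌋≡⌊i/n⌋+j (+ (u ℕ.% n) + k * + (v ℕ.% n)) _ n ⟩
  ⌊ + (u ℕ.% n) + k * + (v ℕ.% n) / n ⌋ + (+ (u ℕ./ n) + k * + (v ℕ./ n))
    ≡⟨ +-comm ⌊ + (u ℕ.% n) + k * + (v ℕ.% n) / n ⌋ _ ⟩
  + (u ℕ./ n) + k * + (v ℕ./ n) + ⌊ + (u ℕ.% n) + k * + (v ℕ.% n) / n ⌋ ∎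
  where
  open ≡-Reasoning
  regroup : ∀ r q k s t n → (r + q * n) + k * (s + t * n) ≡ (r + k * s) + (q + k * t) * n
  regroup = solve-∀

i-k*j : ∀ i k j → i - k * j ≡ i + (- k) * j
i-k*j i k j = cong (_+_ i) (neg-distribˡ-* k j)

⌊affine⁻/n⌋ : ∀ u k v n .{{_ : NonZero n}} → ⌊ + u - k * + v / n ⌋ ≡
  + (u ℕ./ n) - k * + (v ℕ./ n) + ⌊ + (u ℕ.% n) - k * + (v ℕ.% n) / n ⌋
⌊affine⁻/n⌋ u k v n
  rewrite i-k*j (+ u) k (+ v) | i-k*j (+ (u ℕ./ n)) k (+ (v ℕ./ n)) | i-k*j (+ (u ℕ.% n)) k (+ (v ℕ.% n))
  = ⌊affine/n⌋ u (- k) v n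

sumBelow-+ : ∀ m n f → sumBelow (m ℕ.+ n) f ≡ sumBelow m f + sumBelow n (λ i → f (m ℕ.+ i))
sumBelow-+ zero    n f = sym (+-identityˡ _)
sumBelow-+ (suc m) n f = trans (cong (_+_ (f 0)) (sumBelow-+ m n (f ∘ suc)))
  (sym (+-assoc (f 0) _ _))

sumBelow-affine : ∀ n p q (t r : ℕ → ℤ) →
  sumBelow n (λ k → p + t k * q + r k) ≡ + n * p + sumBelow n t * q + sumBelow n r
sumBelow-affine zero    p q t r = sym (empty p q)
  where
  empty : ∀ p q → 0ℤ * p + 0ℤ * q + 0ℤ ≡ 0ℤ
  empty = solve-∀
sumBelow-affine (suc n) p q t r =
  trans (cong (_+_ (p + t 0 * q + r 0)) (sumBelow-affine n p q (t ∘ suc) (r ∘ suc)))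
        (regroup p q (t 0) (r 0) (+ n) (sumBelow n (t ∘ suc)) (sumBelow n (r ∘ suc)))
  where
  regroup : ∀ p q t₀ r₀ n t r →
    (p + t₀ * q + r₀) + (n * p + t * q + r) ≡ (1ℤ + n) * p + (t₀ + t) * q + (r₀ + r)
  regroup = solve-∀

-- The product is exactly twice the sum, so nothing is lost by the floor; the induction is done on
-- the doubled identity.
triangular : ∀ n → sumBelow (suc n) (+_) ≡ ⌊ + n * (1ℤ + + n) / 2 ⌋
triangular n = trans (sym (⌊in/n⌋≡i (sumBelow (suc n) (+_)) 2)) (cong ⌊_/ 2 ⌋ (doubled n))
  where
  doubled : ∀ n → sumBelow (suc n) (+_) * + 2 ≡ + n * (1ℤ + + n)
  doubled zero    = refl
  doubled (suc n) = begin
    sumBelow (suc (suc n)) (+_) * + 2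
      -- `sumBelow` unfolds at its first term, whereas the induction needs the last term split off.
      ≡⟨ cong (λ m → sumBelow (suc m) (+_) * + 2) (ℕ.+-comm n 1) ⟨
    sumBelow (suc n ℕ.+ 1) (+_) * + 2
      ≡⟨ cong (_* + 2) (sumBelow-+ (suc n) 1 (+_)) ⟩
    (sumBelow (suc n) (+_) + (+ (suc n ℕ.+ 0) + 0ℤ)) * + 2
      ≡⟨ cong (λ m → (sumBelow (suc n) (+_) + (+ m + 0ℤ)) * + 2) (ℕ.+-identityʳ (suc n)) ⟩
    (sumBelow (suc n) (+_) + (+ suc n + 0ℤ)) * + 2
      ≡⟨ expand (sumBelow (suc n) (+_)) (+ suc n) ⟩
    sumBelow (suc n) (+_) * + 2 + + suc n * + 2
      ≡⟨ cong (_+ + suc n * + 2) (doubled n) ⟩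
    + n * (1ℤ + + n) + (1ℤ + + n) * + 2
      ≡⟨ factor (+ n) ⟩
    (1ℤ + + n) * (1ℤ + (1ℤ + + n)) ∎
    where
    open ≡-Reasoning
    expand : ∀ s n → (s + (n + 0ℤ)) * + 2 ≡ s * + 2 + n * + 2
    expand = solve-∀
    factor : ∀ n → n * (1ℤ + n) + (1ℤ + n) * + 2 ≡ (1ℤ + n) * (1ℤ + (1ℤ + n))
    factor = solve-∀

-- The number of terms is given additively, as `suc q ≡ p + n`, to avoid a truncated difference.
∑≡sumBelow : ∀ p q n (f : ℤ → ℤ) → suc q ≡ p ℕ.+ n →
  ∑[ + p ⋯ + q ] f ≡ sumBelow n (λ i → f (+ (p ℕ.+ i)))
∑≡sumBelow p q n f eq = cong (λ j → sumBelow ∣ 0ℤ ⊔ j ∣ (λ i → f (+ (p ℕ.+ i)))) (begin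
  + suc q - + p        ≡⟨ cong (λ m → + m - + p) eq ⟩
  + p + + n - + p      ≡⟨ cancel (+ p) (+ n) ⟩
  + n                  ∎)
  where
  open ≡-Reasoning
  cancel : ∀ p n → p + n - p ≡ n
  cancel = solve-∀

-- Row lengths on one side of the diagonal

-- Row k of one side of the staircase is the interval k < p ≤ F k.
module _ {C : ℕ → ℕ → Set} {F : ℕ → ℤ} {n : ℕ} (C⇔≤F : ∀ p k → C p k ⇔ + p ≤ F k)
  (C-diagonal : ∀ {k} → k ℕ.< n → C k k) (C⇒<n : ∀ {k j} → C (suc (k ℕ.+ j)) k → k ℕ.< n) where
  open Equivalence

  rowLength : ℕ → ℕ
  rowLength k = ∣ F k - + k ∣

  -- The diagonal pair satisfies `C`, hence `k ≤ F k` and the absolute value in `rowLength` changes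
  -- nothing.
  rowLength≡ : ∀ {k} → k ℕ.< n → + rowLength k ≡ F k - + k
  rowLength≡ {k} k<n = 0≤i⇒+∣i∣≡i (i≤j⇒0≤j-i (to (C⇔≤F k k) (C-diagonal k<n)))

  +rowLength≡F : ∀ {k} → k ℕ.< n → + (k ℕ.+ rowLength k) ≡ F k
  +rowLength≡F {k} k<n = trans (cong (_+_ (+ k)) (rowLength≡ k<n)) (cancel (+ k) (F k))
    where
    cancel : ∀ k f → k + (f - k) ≡ f
    cancel = solve-∀

  C⇔rowLength : ∀ k j → C (suc (k ℕ.+ j)) k ⇔ (k ℕ.< n × j ℕ.< rowLength k)
  C⇔rowLength k j = mk⇔
    (λ d → let k<n = C⇒<n d in k<n ,
      ℕ.+-cancelˡ-< k _ _ (drop‿+≤+ (subst (+ suc (k ℕ.+ j) ≤_) (sym (+rowLength≡F k<n)) (to (C⇔≤F _ k) d))))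
    (λ (k<n , j<) → from (C⇔≤F _ k)
      (subst (+ suc (k ℕ.+ j) ≤_) (+rowLength≡F k<n) (+≤+ (ℕ.+-monoʳ-< k j<))))

i+k≤j⇔i≤j-k : ∀ i j k → i + k ≤ j ⇔ i ≤ j - k
i+k≤j⇔i≤j-k i j k = mk⇔
  (subst (_≤ j - k) (cancel i k) ∘ +-monoˡ-≤ (- k))
  (subst (i + k ≤_) (cancel⁻ j k) ∘ +-monoˡ-≤ k)
  where
  cancel : ∀ i k → i + k - k ≡ i
  cancel = solve-∀
  cancel⁻ : ∀ i k → i - k + k ≡ i
  cancel⁻ = solve-∀

-- The side p > q has (v , u) = (y , y₀); the side q > p is the same problem with
-- a, h, y, y₀, δ, θ replaced by b, l, w, x₀, θ, δ.
module Side (a h v u z δ θ A : ℕ) .{{_ : NonZero a}} .{{_ : NonZero δ}}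
  (a≡ : + a ≡ + h * + δ + + v * + θ) (v≤h : v ℕ.≤ h) (u<h : u ℕ.< h)
  (≤z⇔≤A : ∀ k → + k * (+ δ + + θ) ≤ + z ⇔ k ℕ.< suc A) where

  open Equivalence

  -- The nonnegativity conditions that can fail when the first argument is the larger one. The
  -- remaining coordinate is then nonnegative by `w < l` or `y < h`.
  C : ℕ → ℕ → Set
  C p q = + p * + v ≤ + u + + q * + h × + p * + δ + + q * + θ ≤ + z

  RowLengths : (ℕ → ℕ) → Set
  RowLengths α = ∀ k j → C (suc (k ℕ.+ j)) k ⇔ (k ℕ.< suc A × j ℕ.< α k)

  C-diagonal : ∀ {k} → k ℕ.< suc A → C k k
  C-diagonal {k} k<n =
    ≤-trans (*-monoˡ-≤-nonNeg (+ k) (+≤+ v≤h)) (subst (_≤ + u + + k * + h) (+-identityˡ _)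
      (+-monoˡ-≤ (+ k * + h) (nonNeg u))) ,
    subst (_≤ + z) (*-distribˡ-+ (+ k) (+ δ) (+ θ)) (from (≤z⇔≤A k) k<n)

  C⇒≤A : ∀ {k j} → C (suc (k ℕ.+ j)) k → k ℕ.< suc A
  C⇒≤A {k} {j} (_ , ≤z) = to (≤z⇔≤A k) (subst (_≤ + z) (sym (*-distribˡ-+ (+ k) (+ δ) (+ θ)))
    (≤-trans (+-monoˡ-≤ (+ k * + θ) (*-monoʳ-≤-nonNeg (+ δ)
      (+≤+ (ℕ.≤-trans (ℕ.m≤m+n k j) (ℕ.n≤1+n _))))) ≤z))

  -- After multiplication by `v`, the chain is `v(pδ + kθ) ≤ (u + kh)δ + kvθ = uδ + ka <
  -- vz`. As the result is strict, `v` can be cancelled knowing only that it is nonnegative.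
  threshold-< : ∀ {p k} → + k * + a < + z * + v - + u * + δ →
    + p * + v ≤ + u + + k * + h → + p * + δ + + k * + θ ≤ + z
  threshold-< {p} {k} ka< pv≤ = <⇒≤ (*-cancelˡ-<-nonNeg (+ v) (begin-strict
    + v * (+ p * + δ + + k * + θ)
      ≡⟨ regroup (+ p) (+ k) (+ v) (+ δ) (+ θ) ⟩
    (+ p * + v) * + δ + + k * (+ v * + θ)
      ≤⟨ +-monoˡ-≤ (+ k * (+ v * + θ)) (*-monoʳ-≤-nonNeg (+ δ) pv≤) ⟩
    (+ u + + k * + h) * + δ + + k * (+ v * + θ)
      ≡⟨ regroup′ (+ u) (+ k) (+ h) (+ δ) (+ v * + θ) ⟩
    + u * + δ + + k * (+ h * + δ + + v * + θ)
      ≡⟨ cong (λ i → + u * + δ + + k * i) a≡ ⟨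
    + u * + δ + + k * + a
      <⟨ +-monoʳ-< (+ u * + δ) ka< ⟩
    + u * + δ + (+ z * + v - + u * + δ)
      ≡⟨ cancel (+ u * + δ) (+ z) (+ v) ⟩
    + v * + z ∎))
    where
    open ≤-Reasoning
    regroup : ∀ p k v δ θ → v * (p * δ + k * θ) ≡ (p * v) * δ + k * (v * θ)
    regroup = solve-∀
    regroup′ : ∀ u k h δ vθ → (u + k * h) * δ + k * vθ ≡ u * δ + k * (h * δ + vθ)
    regroup′ = solve-∀
    cancel : ∀ i z v → i + (z * v - i) ≡ v * z
    cancel = solve-∀

  -- After multiplication by `δ`, the chain is `pvδ ≤ vz - kvθ ≤ ka + uδ - kvθ = (u + kh)δ`, and `δ
  -- > 0` is cancelled.
  threshold-≥ : ∀ {p k} → + z * + v - + u * + δ ≤ + k * + a →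
    + p * + δ + + k * + θ ≤ + z → + p * + v ≤ + u + + k * + h
  threshold-≥ {p} {k} ≤ka ≤z = *-cancelʳ-≤-pos (+ p * + v) (+ u + + k * + h) (+ δ) {{δ>0}} (begin
    (+ p * + v) * + δ
      ≡⟨ regroup (+ p) (+ k) (+ v) (+ δ) (+ θ) ⟩
    + v * (+ p * + δ + + k * + θ) - + k * (+ v * + θ)
      ≤⟨ +-monoˡ-≤ (- (+ k * (+ v * + θ))) (*-monoˡ-≤-nonNeg (+ v) ≤z) ⟩
    + v * + z - + k * (+ v * + θ)
      ≡⟨ regroup′ (+ u) (+ δ) (+ z) (+ v) (+ k * (+ v * + θ)) ⟩
    (+ z * + v - + u * + δ) + (+ u * + δ - + k * (+ v * + θ))
      ≤⟨ +-monoˡ-≤ (+ u * + δ - + k * (+ v * + θ)) ≤ka ⟩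
    + k * + a + (+ u * + δ - + k * (+ v * + θ))
      ≡⟨ cong (λ i → + k * i + (+ u * + δ - + k * (+ v * + θ))) a≡ ⟩
    + k * (+ h * + δ + + v * + θ) + (+ u * + δ - + k * (+ v * + θ))
      ≡⟨ cancel (+ u) (+ k) (+ h) (+ δ) (+ v * + θ) ⟩
    (+ u + + k * + h) * + δ ∎)
    where
    open ≤-Reasoning
    δ>0 = ℤ.positive (positive δ)
    regroup : ∀ p k v δ θ → (p * v) * δ ≡ v * (p * δ + k * θ) - k * (v * θ)
    regroup = solve-∀
    regroup′ : ∀ u δ z v i → v * z - i ≡ (z * v - u * δ) + (u * δ - i)
    regroup′ = solve-∀
    cancel : ∀ u k h δ i → k * (h * δ + i) + (u * δ - k * i) ≡ (u + k * h) * δ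
    cancel = solve-∀

  z̄ θ̄ T : ℤ
  z̄ = + (z ℕ./ δ)
  θ̄ = + (θ ℕ./ δ)
  T = ⌊ + A * (1ℤ + + A) / 2 ⌋

  s : ℤ → ℤ
  s k = ⌊ + (z ℕ.% δ) - k * + (θ ℕ.% δ) / δ ⌋

  -- This is `𝓐₀` on the lower side and `𝓑₀` on the upper side.
  S₀ : ℤ
  S₀ = (1ℤ + + A) * z̄ - (θ̄ + 1ℤ) * T + ∑[ 0ℤ ⋯ + A ] s

  Z : ℕ → ℤ
  Z k = ⌊ + z - + k * + θ / δ ⌋

  ≤z⇔≤Z : ∀ p k → + p * + δ + + k * + θ ≤ + z ⇔ + p ≤ Z k
  ≤z⇔≤Z p k = ⇔-trans (i+k≤j⇔i≤j-k (+ p * + δ) (+ z) (+ k * + θ)) (*n≤⇔≤⌊/n⌋ (+ p) (+ z - + k * + θ) δ)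

  Z-k : ∀ k → Z k - + k ≡ z̄ + + k * - (θ̄ + 1ℤ) + s (+ k)
  Z-k k = trans (cong (_- + k) (⌊affine⁻/n⌋ z (+ k) θ δ)) (regroup z̄ θ̄ (s (+ k)) (+ k))
    where
    regroup : ∀ z̄ θ̄ s k → (z̄ - k * θ̄ + s) - k ≡ z̄ + k * - (θ̄ + 1ℤ) + s
    regroup = solve-∀

  -- The offset `K` serves the rows from the threshold on.
  sum-Z : ∀ K n → sumBelow n (λ i → Z (K ℕ.+ i) - + (K ℕ.+ i)) ≡
    + n * z̄ + sumBelow n (λ i → + (K ℕ.+ i)) * - (θ̄ + 1ℤ) + sumBelow n (λ i → s (+ (K ℕ.+ i)))
  sum-Z K n = trans (sumBelow-cong n λ {i} _ → Z-k (K ℕ.+ i))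
    (sumBelow-affine n z̄ (- (θ̄ + 1ℤ)) (λ i → + (K ℕ.+ i)) (λ i → s (+ (K ℕ.+ i))))

  sumZ≡S₀ : sumBelow (suc A) (λ k → Z k - + k) ≡ S₀
  sumZ≡S₀ = begin
    sumBelow (suc A) (λ k → Z k - + k)
      ≡⟨ sum-Z 0 (suc A) ⟩
    + suc A * z̄ + sumBelow (suc A) (+_) * - (θ̄ + 1ℤ) + sumBelow (suc A) (λ i → s (+ i))
      ≡⟨ cong₂ (λ t σ → + suc A * z̄ + t * - (θ̄ + 1ℤ) + σ) (triangular A)
           (sym (∑≡sumBelow 0 A (suc A) s refl)) ⟩
    + suc A * z̄ + T * - (θ̄ + 1ℤ) + ∑[ 0ℤ ⋯ + A ] s
      ≡⟨ regroup (+ suc A * z̄) T θ̄ (∑[ 0ℤ ⋯ + A ] s) ⟩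
    S₀ ∎
    where
    open ≡-Reasoning
    regroup : ∀ i T θ̄ σ → i + T * - (θ̄ + 1ℤ) + σ ≡ i - (θ̄ + 1ℤ) * T + σ
    regroup = solve-∀

  -- The bound `G` is abstract and constrained only below `K`, because for `v = 0` there is no floor
  -- of a division by `v`; in that case `K = 0` and any `G` will do.
  module Threshold (K : ℕ) (<K⇔ : ∀ k → + k * + a < + z * + v - + u * + δ ⇔ k ℕ.< K) (G : ℕ → ℤ)
    (≤u⇔≤G : ∀ {k} → k ℕ.< K → ∀ p → + p * + v ≤ + u + + k * + h ⇔ + p ≤ G k) where

    F : ℕ → ℤ
    F k = if does (k ℕ.<? K) then G k else Z k

    F≡G : ∀ {k} → k ℕ.< K → F k ≡ G k
    F≡G {k} k<K = cong (if_then G k else Z k) (dec-true (k ℕ.<? K) k<K)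

    F≡Z : ∀ {k} → ¬ k ℕ.< K → F k ≡ Z k
    F≡Z {k} k≮K = cong (if_then G k else Z k) (dec-false (k ℕ.<? K) k≮K)

    -- Before the threshold the first constraint implies the second, and from the threshold on the
    -- second implies the first, so one bound decides each row.
    C⇔≤F : ∀ p k → C p k ⇔ + p ≤ F k
    C⇔≤F p k with k ℕ.<? K
    ... | yes k<K = subst (λ f → C p k ⇔ + p ≤ f) (sym (F≡G k<K)) (mk⇔
      (to (≤u⇔≤G k<K p) ∘ proj₁)
      (λ p≤G → let pv≤ = from (≤u⇔≤G k<K p) p≤G in pv≤ , threshold-< {p} {k} (from (<K⇔ k) k<K) pv≤))
    ... | no k≮K = subst (λ f → C p k ⇔ + p ≤ f) (sym (F≡Z k≮K)) (mk⇔
      (to (≤z⇔≤Z p k) ∘ proj₂)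
      (λ p≤Z → let ≤z = from (≤z⇔≤Z p k) p≤Z in threshold-≥ {p} {k} (≮⇒≥ (k≮K ∘ to (<K⇔ k))) ≤z , ≤z))

    α : ℕ → ℕ
    α = rowLength C⇔≤F C-diagonal C⇒≤A

    α-rowLengths : RowLengths α
    α-rowLengths = C⇔rowLength C⇔≤F C-diagonal C⇒≤A

    sum-α : sumBelow (suc A) (λ k → + α k) ≡ sumBelow (suc A) (λ k → F k - + k)
    sum-α = sumBelow-cong (suc A) (rowLength≡ C⇔≤F C-diagonal C⇒≤A)

    sum-α-0 : K ≡ 0 → sumBelow (suc A) (λ k → + α k) ≡ S₀
    sum-α-0 refl = trans sum-α (trans (sumBelow-cong (suc A) {f = λ k → F k - + k} λ {k} _ →
      cong (_- + k) (F≡Z {k} λ ())) sumZ≡S₀)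

  -- For `v = 0` the threshold condition reads `ka < - uδ`, which is never true; so every row is
  -- bounded by the third coordinate.
  rowLengths-0 : v ≡ 0 → ∃ λ α → RowLengths α × sumBelow (suc A) (λ k → + α k) ≡ S₀
  rowLengths-0 v≡0 = α , α-rowLengths , sum-α-0 refl
    where
    never : ∀ k → ¬ + k * + a < + z * + v - + u * + δ
    never k = ≤⇒≯ (≤-trans (subst (_≤ 0ℤ) (sym (trans (cong (λ i → + z * + i - + u * + δ) v≡0)
      (regroup (+ z) (+ u * + δ)))) (neg-mono-≤ (*-nonNeg u δ))) (*-nonNeg k a))
      where
      regroup : ∀ z i → z * 0ℤ - i ≡ - i
      regroup = solve-∀
    open Threshold 0 (λ k → mk⇔ (λ lt → contradiction lt (never k)) (λ ())) (λ _ → 0ℤ) (λ ())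

  -- The threshold and the three closed forms

  k₁ : ℤ
  k₁ = ⌈ + z * + v - + u * + δ / a ⌉

  -- It suffices that `-1 < k₁`, that is `- a < zv - uδ`, and this holds since `a ≥ hδ > uδ`.
  0≤k₁ : 0ℤ ≤ k₁
  0≤k₁ = i<j⇒suc[i]≤j (to (*n<⇔<⌈/n⌉ -1ℤ _ a) (begin-strict
    -1ℤ * + a
      ≡⟨ trans (-1*i≡-i (+ a)) (cong -_ a≡) ⟩
    - (+ h * + δ + + v * + θ)
      ≤⟨ neg-mono-≤ (subst (_≤ + h * + δ + + v * + θ) (+-identityʳ _)
           (+-monoʳ-≤ (+ h * + δ) (*-nonNeg v θ))) ⟩
    - (+ h * + δ)
      <⟨ neg-mono-< (*-monoʳ-<-pos (+ δ) {{ℤ.positive (positive δ)}} (+<+ u<h)) ⟩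
    - (+ u * + δ)
      ≡⟨ +-identityˡ _ ⟨
    0ℤ - + u * + δ
      ≤⟨ +-monoˡ-≤ (- (+ u * + δ)) (*-nonNeg z v) ⟩
    + z * + v - + u * + δ ∎))
    where open ≤-Reasoning

  module _ .{{_ : NonZero v}} where

    ū h̄ : ℤ
    ū = + (u ℕ./ v)
    h̄ = + (h ℕ./ v)

    r : ℤ → ℤ
    r k = ⌊ + (u ℕ.% v) + k * + (h ℕ.% v) / v ⌋

    -- `S₁` and `S₂` become `𝓐₁` and `𝓐₂` on the lower side, `𝓑₁` and `𝓑₂` on the upper side.
    S₁ : ℤ → ℤ → ℤ
    S₁ κ k = (1ℤ + + A) * z̄ + k * (ū - z̄)
       + κ * ⌊ (k - 1ℤ) * k / 2 ⌋
       - (θ̄ + 1ℤ) * T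
       + (∑[ 0ℤ ⋯ k - 1ℤ ] r)
       + (∑[ k ⋯ + A ] s)

    S₂ : ℤ
    S₂ = (1ℤ + + A) * ū + (h̄ - 1ℤ) * T + (∑[ 0ℤ ⋯ + A ] r)

    G : ℕ → ℤ
    G k = ⌊ + u + + k * + h / v ⌋

    sum-G : ∀ n → sumBelow n (λ k → G k - + k) ≡
      + n * ū + sumBelow n (+_) * (h̄ - 1ℤ) + sumBelow n (λ k → r (+ k))
    sum-G n = trans
      (sumBelow-cong n λ {k} _ → trans (cong (_- + k) (⌊affine/n⌋ u (+ k) h v)) (regroup ū h̄ (r (+ k)) (+ k)))
      (sumBelow-affine n ū (h̄ - 1ℤ) (+_) (λ k → r (+ k)))
      where
      regroup : ∀ ū h̄ r k → (ū + k * h̄ + r) - k ≡ ū + k * (h̄ - 1ℤ) + r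
      regroup = solve-∀

    +∣k₁∣≡k₁ : + ∣ k₁ ∣ ≡ k₁
    +∣k₁∣≡k₁ = 0≤i⇒+∣i∣≡i 0≤k₁

    <∣k₁∣⇔ : ∀ k → + k * + a < + z * + v - + u * + δ ⇔ k ℕ.< ∣ k₁ ∣
    <∣k₁∣⇔ k = ⇔-trans (*n<⇔<⌈/n⌉ (+ k) _ a) (mk⇔
      (drop‿+<+ ∘ subst (+ k <_) (sym +∣k₁∣≡k₁)) (subst (+ k <_) +∣k₁∣≡k₁ ∘ +<+))

    open Threshold ∣ k₁ ∣ <∣k₁∣⇔ G (λ {k} _ p → *n≤⇔≤⌊/n⌋ (+ p) (+ u + + k * + h) v)

    sum-α-2 : A ℕ.< ∣ k₁ ∣ → sumBelow (suc A) (λ k → + α k) ≡ S₂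
    sum-α-2 A<K = begin
      sumBelow (suc A) (λ k → + α k)
        ≡⟨ sum-α ⟩
      sumBelow (suc A) (λ k → F k - + k)
        ≡⟨ sumBelow-cong (suc A) (λ {k} k<n → cong (_- + k) (F≡G (ℕ.<-≤-trans k<n A<K))) ⟩
      sumBelow (suc A) (λ k → G k - + k)
        ≡⟨ sum-G (suc A) ⟩
      + suc A * ū + sumBelow (suc A) (+_) * (h̄ - 1ℤ) + sumBelow (suc A) (λ k → r (+ k))
        ≡⟨ cong₂ (λ t σ → + suc A * ū + t + σ)
             (trans (cong (_* (h̄ - 1ℤ)) (triangular A)) (*-comm T (h̄ - 1ℤ)))
             (sym (∑≡sumBelow 0 A (suc A) r refl)) ⟩
      S₂ ∎
      where open ≡-Reasoning

    -- The rows are split at the threshold `K`. With `t` and `t′` the sums of the indices before and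
    -- after it, `(h̄ - 1)t - (θ̄ + 1)t′ = (θ̄ + h̄)t - (θ̄ + 1)(t + t′)`, and `t + t′` is the full
    -- triangular number. The form `suc K′` makes `k - 1` a natural number, so that `triangular K′`
    -- applies to `t`.
    sum-α-1 : ∀ κ → κ ≡ θ̄ + h̄ → ∀ K′ M → ∣ k₁ ∣ ≡ suc K′ → suc A ≡ suc K′ ℕ.+ M →
      sumBelow (suc A) (λ k → + α k) ≡ S₁ κ (+ suc K′)
    sum-α-1 κ κ≡ K′ M k₁≡ A≡ = begin
      sumBelow (suc A) (λ k → + α k)
        ≡⟨ sum-α ⟩
      sumBelow (suc A) (λ k → F k - + k)
        ≡⟨ cong (λ n → sumBelow n (λ k → F k - + k)) A≡ ⟩
      sumBelow (K ℕ.+ M) (λ k → F k - + k)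
        ≡⟨ sumBelow-+ K M (λ k → F k - + k) ⟩
      sumBelow K (λ k → F k - + k) + sumBelow M (λ i → F (K ℕ.+ i) - + (K ℕ.+ i))
        ≡⟨ cong₂ _+_
             (sumBelow-cong K λ {k} k<K → cong (_- + k) (F≡G (ℕ.<-≤-trans k<K (ℕ.≤-reflexive (sym k₁≡)))))
             (sumBelow-cong M λ {i} _ → cong (_- + (K ℕ.+ i)) (F≡Z (ℕ.≤⇒≯
               (ℕ.≤-trans (ℕ.≤-reflexive k₁≡) (ℕ.m≤m+n K i))))) ⟩
      sumBelow K (λ k → G k - + k) + sumBelow M (λ i → Z (K ℕ.+ i) - + (K ℕ.+ i))
        ≡⟨ cong₂ _+_ (sum-G K) (sum-Z K M) ⟩
      (+ K * ū + t * (h̄ - 1ℤ) + ρ) + (+ M * z̄ + t′ * - (θ̄ + 1ℤ) + σ)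
        ≡⟨ regroup (+ K) (+ M) ū z̄ θ̄ h̄ t t′ ρ σ ⟩
      (+ K + + M) * z̄ + + K * (ū - z̄) + (θ̄ + h̄) * t - (θ̄ + 1ℤ) * (t + t′) + ρ + σ
        ≡⟨ cong₂ (λ n T → n * z̄ + + K * (ū - z̄) + (θ̄ + h̄) * t - (θ̄ + 1ℤ) * T + ρ + σ)
             (cong +_ (sym A≡))
             (trans (sym (sumBelow-+ K M (+_))) (trans (cong (λ n → sumBelow n (+_)) (sym A≡)) (triangular A))) ⟩
      (1ℤ + + A) * z̄ + + K * (ū - z̄) + (θ̄ + h̄) * t - (θ̄ + 1ℤ) * T + ρ + σ
        ≡⟨ cong₂ (λ κ t → (1ℤ + + A) * z̄ + + K * (ū - z̄) + κ * t - (θ̄ + 1ℤ) * T + ρ + σ)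
             (sym κ≡) (triangular K′) ⟩
      (1ℤ + + A) * z̄ + + K * (ū - z̄) + κ * ⌊ + K′ * + K / 2 ⌋ - (θ̄ + 1ℤ) * T + ρ + σ
        ≡⟨ cong₂ (λ ρ σ → (1ℤ + + A) * z̄ + + K * (ū - z̄) + κ * ⌊ + K′ * + K / 2 ⌋ - (θ̄ + 1ℤ) * T + ρ + σ)
             (∑≡sumBelow 0 K′ K r refl) (∑≡sumBelow K A M s A≡) ⟨
      S₁ κ (+ K) ∎
      where
      open ≡-Reasoning
      K = suc K′
      t = sumBelow K (+_)
      t′ = sumBelow M (λ i → + (K ℕ.+ i))
      ρ = sumBelow K (λ k → r (+ k))
      σ = sumBelow M (λ i → s (+ (K ℕ.+ i)))
      regroup : ∀ K M ū z̄ θ̄ h̄ t t′ ρ σ →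
        (K * ū + t * (h̄ - 1ℤ) + ρ) + (M * z̄ + t′ * - (θ̄ + 1ℤ) + σ) ≡
        (K + M) * z̄ + K * (ū - z̄) + (θ̄ + h̄) * t - (θ̄ + 1ℤ) * (t + t′) + ρ + σ
      regroup = solve-∀

    -- κ is a parameter because 𝓐₁ and 𝓑₁ write the sum θ̄ + h̄ in opposite orders.
    rowLengths-+ : ∀ κ → κ ≡ θ̄ + h̄ → ∃ λ α → RowLengths α × sumBelow (suc A) (λ k → + α k) ≡
      (if does (k₁ ≟ 0ℤ) then S₀ else if does (k₁ ≤? + A) then S₁ κ k₁ else S₂)
    rowLengths-+ κ κ≡ = α , α-rowLengths , sum
      where
      k₁≡+ : ∀ {K} → ∣ k₁ ∣ ≡ K → k₁ ≡ + K
      k₁≡+ eq = trans (sym +∣k₁∣≡k₁) (cong +_ eq)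
      sum-α-1′ : ∀ K → ∣ k₁ ∣ ≡ K → ¬ k₁ ≡ 0ℤ → k₁ ≤ + A → sumBelow (suc A) (λ k → + α k) ≡ S₁ κ k₁
      sum-α-1′ zero eq k₁≢0 _ = contradiction (k₁≡+ eq) k₁≢0
      sum-α-1′ (suc K′) eq _ k₁≤A
        with M , M≡ ← ℕ.m≤n⇒∃[o]m+o≡n (ℕ.m≤n⇒m≤1+n (drop‿+≤+ (subst (_≤ + A) (k₁≡+ eq) k₁≤A)))
        = trans (sum-α-1 κ κ≡ K′ M eq (sym M≡)) (cong (S₁ κ) (sym (k₁≡+ eq)))
      sum : sumBelow (suc A) (λ k → + α k) ≡
        (if does (k₁ ≟ 0ℤ) then S₀ else if does (k₁ ≤? + A) then S₁ κ k₁ else S₂)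
      sum with k₁ ≟ 0ℤ
      ... | yes k₁≡0 = sum-α-0 (cong ∣_∣ k₁≡0)
      ... | no k₁≢0 with k₁ ≤? + A
      ...   | yes k₁≤A = sum-α-1′ ∣ k₁ ∣ refl k₁≢0 k₁≤A
      ...   | no k₁≰A = sum-α-2 (drop‿+<+ (subst (+ A <_) (sym +∣k₁∣≡k₁) (≰⇒> k₁≰A)))

-- Linear relations between the generators and the L-shape

module Counting (a b c : ℕ) .{{_ : NonZero a}} .{{_ : NonZero b}} .{{_ : NonZero c}}
  (l h w y : ℕ) (w<l : w ℕ.< l) (y<h : y ℕ.< h) (related : IsRelated a b c (LShape l h w y))
  (δ θ : ℕ) .{{_ : NonZero δ}} .{{_ : NonZero θ}}
  (δc≡ : + δ * + c ≡ + l * + a - + y * + b) (θc≡ : + θ * + c ≡ + h * + b - + w * + a) where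

  module Related = IsRelated related

  -- The area of the L-shape is also the determinant of the translations `(l , - y)` and
  -- `(- w , h)`.
  det≡c : + l * + h - + w * + y ≡ + c
  det≡c = begin
    + l * + h - + w * + y
      ≡⟨ cong₂ _-_ (trans (sym (pos-* l h)) (cong +_ (sym lh≡))) (sym (pos-* w y)) ⟩
    + (c ℕ.+ w ℕ.* y) - + (w ℕ.* y)
      ≡⟨ cancel (+ c) (+ (w ℕ.* y)) ⟩
    + c ∎
    where
    open ≡-Reasoning
    lh≡ : c ℕ.+ w ℕ.* y ≡ l ℕ.* h
    lh≡ = trans (cong (ℕ._+ w ℕ.* y) (sym Related.size)) (length-LShape l h w y (ℕ.<⇒≤ w<l) (ℕ.<⇒≤ y<h))
    cancel : ∀ i j → i + j - j ≡ i
    cancel = solve-∀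

  -- Cramer's rule: the equations for `δc` and `θc` are a linear system in `a` and `b` with
  -- determinant `c`.
  a≡hδ+yθ : + a ≡ + h * + δ + + y * + θ
  a≡hδ+yθ = *-cancelʳ-≡ (+ a) (+ h * + δ + + y * + θ) (+ c) (begin
    + a * + c
      ≡⟨ cong (_*_ (+ a)) det≡c ⟨
    + a * (+ l * + h - + w * + y)
      ≡⟨ expand (+ a) (+ b) (+ l) (+ h) (+ w) (+ y) ⟩
    + h * (+ l * + a - + y * + b) + + y * (+ h * + b - + w * + a)
      ≡⟨ cong₂ (λ i j → + h * i + + y * j) δc≡ θc≡ ⟨
    + h * (+ δ * + c) + + y * (+ θ * + c)
      ≡⟨ factor (+ h) (+ y) (+ δ) (+ θ) (+ c) ⟩
    (+ h * + δ + + y * + θ) * + c ∎)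
    where
    open ≡-Reasoning
    expand : ∀ a b l h w y → a * (l * h - w * y) ≡ h * (l * a - y * b) + y * (h * b - w * a)
    expand = solve-∀
    factor : ∀ h y δ θ c → h * (δ * c) + y * (θ * c) ≡ (h * δ + y * θ) * c
    factor = solve-∀

  -- Cramer's rule for the other unknown. The summands are in the order that `Side` expects after
  -- the exchange of roles.
  b≡lθ+wδ : + b ≡ + l * + θ + + w * + δ
  b≡lθ+wδ = *-cancelʳ-≡ (+ b) (+ l * + θ + + w * + δ) (+ c) (begin
    + b * + c
      ≡⟨ cong (_*_ (+ b)) det≡c ⟨
    + b * (+ l * + h - + w * + y)
      ≡⟨ expand (+ a) (+ b) (+ l) (+ h) (+ w) (+ y) ⟩
    + l * (+ h * + b - + w * + a) + + w * (+ l * + a - + y * + b)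
      ≡⟨ cong₂ (λ i j → + l * i + + w * j) θc≡ δc≡ ⟨
    + l * (+ θ * + c) + + w * (+ δ * + c)
      ≡⟨ factor (+ l) (+ w) (+ θ) (+ δ) (+ c) ⟩
    (+ l * + θ + + w * + δ) * + c ∎)
    where
    open ≡-Reasoning
    expand : ∀ a b l h w y → b * (l * h - w * y) ≡ l * (h * b - w * a) + w * (l * a - y * b)
    expand = solve-∀
    factor : ∀ h y δ θ c → h * (δ * c) + y * (θ * c) ≡ (h * δ + y * θ) * c
    factor = solve-∀

  from-difference : ∀ {k i j} → + k * + c ≡ + i - + j → i ≡ j ℕ.+ k ℕ.* c
  from-difference {k} {i} {j} eq = +-injective (begin
    + i                 ≡⟨ cancel (+ i) (+ j) ⟩
    + j + (+ i - + j)   ≡⟨ cong (_+_ (+ j)) (trans (sym eq) (sym (pos-* k c))) ⟩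
    + (j ℕ.+ k ℕ.* c)   ∎)
    where
    open ≡-Reasoning
    cancel : ∀ i j → i ≡ j + (i - j)
    cancel = solve-∀

  la≡yb+δc : l ℕ.* a ≡ y ℕ.* b ℕ.+ δ ℕ.* c
  la≡yb+δc = from-difference {δ} {l ℕ.* a} {y ℕ.* b} (trans δc≡ (sym (cong₂ _-_ (pos-* l a) (pos-* y b))))

  hb≡wa+θc : h ℕ.* b ≡ w ℕ.* a ℕ.+ θ ℕ.* c
  hb≡wa+θc = from-difference {θ} {h ℕ.* b} {w ℕ.* a} (trans θc≡ (sym (cong₂ _-_ (pos-* h b) (pos-* w a))))

  -- The sum of the two translations; the truncated differences are exact by `w < l` and `y < h`.
  corner≡ : (l ∸ w) ℕ.* a ℕ.+ (h ∸ y) ℕ.* b ≡ (δ ℕ.+ θ) ℕ.* c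
  corner≡ = ℕ.+-cancelˡ-≡ (w ℕ.* a ℕ.+ y ℕ.* b) _ _ (begin
    w ℕ.* a ℕ.+ y ℕ.* b ℕ.+ ((l ∸ w) ℕ.* a ℕ.+ (h ∸ y) ℕ.* b)
      ≡⟨ regroup w y a b (l ∸ w) (h ∸ y) ⟩
    (w ℕ.+ (l ∸ w)) ℕ.* a ℕ.+ (y ℕ.+ (h ∸ y)) ℕ.* b
      ≡⟨ cong₂ (λ i j → i ℕ.* a ℕ.+ j ℕ.* b) (ℕ.m+[n∸m]≡n (ℕ.<⇒≤ w<l)) (ℕ.m+[n∸m]≡n (ℕ.<⇒≤ y<h)) ⟩
    l ℕ.* a ℕ.+ h ℕ.* b
      ≡⟨ cong₂ ℕ._+_ la≡yb+δc hb≡wa+θc ⟩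
    y ℕ.* b ℕ.+ δ ℕ.* c ℕ.+ (w ℕ.* a ℕ.+ θ ℕ.* c)
      ≡⟨ regroup′ (y ℕ.* b) (w ℕ.* a) δ θ c ⟩
    w ℕ.* a ℕ.+ y ℕ.* b ℕ.+ (δ ℕ.+ θ) ℕ.* c ∎)
    where
    open ≡-Reasoning
    regroup : ∀ w y a b i j →
      w ℕ.* a ℕ.+ y ℕ.* b ℕ.+ (i ℕ.* a ℕ.+ j ℕ.* b) ≡ (w ℕ.+ i) ℕ.* a ℕ.+ (y ℕ.+ j) ℕ.* b
    regroup = ℕ-Solver.solve-∀
    regroup′ : ∀ i j δ θ c → i ℕ.+ δ ℕ.* c ℕ.+ (j ℕ.+ θ ℕ.* c) ≡ j ℕ.+ i ℕ.+ (δ ℕ.+ θ) ℕ.* c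
    regroup′ = ℕ-Solver.solve-∀

  -- Factorizations as points of a lattice

  module Enumeration (m x₀ y₀ z₀ : ℕ) (basic : IsBasicFactorization a b c (LShape l h w y) m x₀ y₀ z₀) where

    module Basic = IsBasicFactorization basic

    InCorner : ℕ × ℕ → Set
    InCorner (i , j) = l ∸ w ℕ.≤ i × h ∸ y ℕ.≤ j

    inCorner? : ∀ u → Dec (InCorner u)
    inCorner? (i , j) = (l ∸ w ℕ.≤? i) ×-dec (h ∸ y ℕ.≤? j)

    basic∈rectangle : x₀ ℕ.< l × y₀ ℕ.< h
    basic∈rectangle with ∈-cartesianProduct⁻ (upTo l) (upTo h) (proj₁ (∈-filter⁻ (¬? ∘ inCorner?) Basic.basic))
    ... | x₀∈ , y₀∈ = ∈-upTo⁻ x₀∈ , ∈-upTo⁻ y₀∈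

    -- The values are integers because arbitrary `p` and `q` may lead to negative coordinates; `D`
    -- below singles out the pairs for which this does not happen.
    point : ℕ → ℕ → ℤ × ℤ × ℤ
    point p q = + x₀ + + p * + l - + q * + w , + y₀ + + q * + h - + p * + y , + z₀ - (+ p * + δ + + q * + θ)

    ι : ℕ × ℕ × ℕ → ℤ × ℤ × ℤ
    ι (i , j , k) = + i , + j , + k

    ι-injective : ∀ {u v} → ι u ≡ ι v → u ≡ v
    ι-injective eq = cong₂ _,_ (+-injective (cong proj₁ eq))
      (cong₂ _,_ (+-injective (cong (proj₁ ∘ proj₂) eq)) (+-injective (cong (proj₂ ∘ proj₂) eq)))

    -- Cramer's rule recovers `pc` and `qc` from the first two coordinates, and `c` is nonzero.
    point-injective : ∀ {u v} → uncurry point u ≡ uncurry point v → u ≡ v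
    point-injective {p , q} {p′ , q′} eq = cong₂ _,_
      (+-injective (*-cancelʳ-≡ (+ p) (+ p′) (+ c) (trans (p-coordinate p q) (trans
        (cong (λ u → (+ h) * (proj₁ u - + x₀) + + w * (proj₁ (proj₂ u) - + y₀)) eq) (sym (p-coordinate p′ q′))))))
      (+-injective (*-cancelʳ-≡ (+ q) (+ q′) (+ c) (trans (q-coordinate p q) (trans
        (cong (λ u → (+ y) * (proj₁ u - + x₀) + + l * (proj₁ (proj₂ u) - + y₀)) eq) (sym (q-coordinate p′ q′))))))
      where
      p-coordinate : ∀ p q → + p * + c ≡ + h * (proj₁ (point p q) - + x₀) + + w * (proj₁ (proj₂ (point p q)) - + y₀)
      p-coordinate p q = trans (cong (_*_ (+ p)) (sym det≡c)) (identity (+ p) (+ q) (+ x₀) (+ y₀) (+ l) (+ h) (+ w) (+ y))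
        where
        identity : ∀ p q x₀ y₀ l h w y → p * (l * h - w * y) ≡
          h * (x₀ + p * l - q * w - x₀) + w * (y₀ + q * h - p * y - y₀)
        identity = solve-∀
      q-coordinate : ∀ p q → + q * + c ≡ + y * (proj₁ (point p q) - + x₀) + + l * (proj₁ (proj₂ (point p q)) - + y₀)
      q-coordinate p q = trans (cong (_*_ (+ q)) (sym det≡c)) (identity (+ p) (+ q) (+ x₀) (+ y₀) (+ l) (+ h) (+ w) (+ y))
        where
        identity : ∀ p q x₀ y₀ l h w y → q * (l * h - w * y) ≡
          y * (x₀ + p * l - q * w - x₀) + l * (y₀ + q * h - p * y - y₀)
        identity = solve-∀

    _⊕_ : ℤ × ℤ × ℤ → ℤ × ℤ × ℤ → ℤ × ℤ × ℤ
    (i , j , k) ⊕ (i′ , j′ , k′) = i + i′ , j + j′ , k + k′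

    point-step₁ : ∀ p q → point (suc p) q ≡ point p q ⊕ (+ l , - + y , - + δ)
    point-step₁ p q = cong₂ _,_ (first (+ x₀) (+ p) (+ l) (+ q * + w))
      (cong₂ _,_ (second (+ y₀) (+ p) (+ y) (+ q * + h)) (third (+ z₀) (+ p) (+ δ) (+ q * + θ)))
      where
      first : ∀ x p l j → x + (1ℤ + p) * l - j ≡ x + p * l - j + l
      first = solve-∀
      second : ∀ x p y j → x + j - (1ℤ + p) * y ≡ x + j - p * y + - y
      second = solve-∀
      third : ∀ z p δ j → z - ((1ℤ + p) * δ + j) ≡ z - (p * δ + j) + - δ
      third = solve-∀

    point-step₂ : ∀ p q → point p (suc q) ≡ point p q ⊕ (- + w , + h , - + θ)
    point-step₂ p q = cong₂ _,_ (first (+ x₀) (+ q) (+ w) (+ p * + l))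
      (cong₂ _,_ (second (+ y₀) (+ q) (+ h) (+ p * + y)) (third (+ z₀) (+ q) (+ θ) (+ p * + δ)))
      where
      first : ∀ x q w j → x + j - (1ℤ + q) * w ≡ x + j - q * w + - w
      first = solve-∀
      second : ∀ x q h j → x + (1ℤ + q) * h - j ≡ x + q * h - j + h
      second = solve-∀
      third : ∀ z q θ j → z - (j + (1ℤ + q) * θ) ≡ z - (j + q * θ) + - θ
      third = solve-∀

    D : ℕ → ℕ → Set
    D p q = + q * + w ≤ + x₀ + + p * + l × + p * + y ≤ + y₀ + + q * + h × + p * + δ + + q * + θ ≤ + z₀

    basic-residue : ∀ {i j k} → IsFactorization a b c m (i , j , k) →
      (i ℕ.* a ℕ.+ j ℕ.* b) % c ≡ m % c
    basic-residue {i} {j} {k} eq = trans (sym (ℕ.[m+kn]%n≡m%n (i ℕ.* a ℕ.+ j ℕ.* b) k c)) (cong (_% c) eq)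

    -- Modulo `c`, every factorization of `m` has `ia + jb` congruent to `m`, and this residue
    -- determines the square in the L-shape. Cancelling `c` then gives the third coordinate.
    L-shape-unique : ∀ {i j k} → (i , j) ∈ˡ LShape l h w y → IsFactorization a b c m (i , j , k) →
      (i , j , k) ≡ (x₀ , y₀ , z₀)
    L-shape-unique {i} {j} {k} ij∈ eq with Related.residues m
    ... | _ , _ , unique with trans (sym (unique (ij∈ , basic-residue {i} {j} {k} eq)))
                                    (unique (Basic.basic , basic-residue {x₀} {y₀} {z₀} Basic.factorization))
    ...   | refl = cong (λ k → x₀ , y₀ , k) (ℕ.*-cancelʳ-≡ k z₀ c
            (ℕ.+-cancelˡ-≡ (x₀ ℕ.* a ℕ.+ y₀ ℕ.* b) _ _ (trans eq (sym Basic.factorization))))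

    IsPoint : ℕ × ℕ × ℕ → Set
    IsPoint u = ∃₂ λ p q → point p q ≡ ι u

    -- The three moves undo the three reductions, raising `p`, `q` or both by one.
    move₁ : ∀ {i j k} → IsPoint (i , y ℕ.+ j , δ ℕ.+ k) → IsPoint (l ℕ.+ i , j , k)
    move₁ {i} {j} {k} (p , q , eq) = suc p , q , trans (point-step₁ p q)
      (trans (cong (_⊕ (+ l , - + y , - + δ)) eq)
        (cong₂ _,_ (cong +_ (ℕ.+-comm i l)) (cong₂ _,_ (cancel (+ y) (+ j)) (cancel (+ δ) (+ k)))))
      where
      cancel : ∀ u v → u + v + - u ≡ v
      cancel = solve-∀

    move₂ : ∀ {i j k} → IsPoint (w ℕ.+ i , j , θ ℕ.+ k) → IsPoint (i , h ℕ.+ j , k)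
    move₂ {i} {j} {k} (p , q , eq) = p , suc q , trans (point-step₂ p q)
      (trans (cong (_⊕ (- + w , + h , - + θ)) eq)
        (cong₂ _,_ (cancel (+ w) (+ i)) (cong₂ _,_ (cong +_ (ℕ.+-comm j h)) (cancel (+ θ) (+ k)))))
      where
      cancel : ∀ u v → u + v + - u ≡ v
      cancel = solve-∀

    -- The combined move is needed in the missing corner: there `i < l` and `j < h`, so either
    -- single reduction would make a coordinate negative.
    move₁₂ : ∀ {i j k} → IsPoint (i , j , δ ℕ.+ θ ℕ.+ k) → IsPoint (l ∸ w ℕ.+ i , h ∸ y ℕ.+ j , k)
    move₁₂ {i} {j} {k} (p , q , eq) = suc p , suc q , (begin
      point (suc p) (suc q)
        ≡⟨ trans (point-step₂ (suc p) q) (cong (_⊕ (- + w , + h , - + θ)) (point-step₁ p q)) ⟩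
      (point p q ⊕ (+ l , - + y , - + δ)) ⊕ (- + w , + h , - + θ)
        ≡⟨ cong (λ u → (u ⊕ (+ l , - + y , - + δ)) ⊕ (- + w , + h , - + θ)) eq ⟩
      (ι (i , j , δ ℕ.+ θ ℕ.+ k) ⊕ (+ l , - + y , - + δ)) ⊕ (- + w , + h , - + θ)
        ≡⟨ cong₂ (λ u v → (ι (i , j , δ ℕ.+ θ ℕ.+ k) ⊕ (+ u , - + y , - + δ)) ⊕ (- + w , + v , - + θ))
             (ℕ.m+[n∸m]≡n (ℕ.<⇒≤ w<l)) (ℕ.m+[n∸m]≡n (ℕ.<⇒≤ y<h)) ⟨
      (ι (i , j , δ ℕ.+ θ ℕ.+ k) ⊕ (+ (w ℕ.+ (l ∸ w)) , - + y , - + δ)) ⊕ (- + w , + (y ℕ.+ (h ∸ y)) , - + θ)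
        ≡⟨ cong₂ _,_ (first (+ i) (+ w) (+ (l ∸ w)))
             (cong₂ _,_ (second (+ j) (+ y) (+ (h ∸ y))) (third (+ δ) (+ θ) (+ k))) ⟩
      ι (l ∸ w ℕ.+ i , h ∸ y ℕ.+ j , k) ∎)
      where
      open ≡-Reasoning
      first : ∀ i w e → i + (w + e) + - w ≡ e + i
      first = solve-∀
      second : ∀ j y e → j + - y + (y + e) ≡ e + j
      second = solve-∀
      third : ∀ δ θ k → δ + θ + k + - δ + - θ ≡ k
      third = solve-∀

    factorization₁ : ∀ {i j k} → IsFactorization a b c m (l ℕ.+ i , j , k) →
      IsFactorization a b c m (i , y ℕ.+ j , δ ℕ.+ k)
    factorization₁ {i} {j} {k} eq = trans (expand i y j δ k a b c) (trans
      (cong (ℕ._+ (i ℕ.* a ℕ.+ j ℕ.* b ℕ.+ k ℕ.* c)) (sym la≡yb+δc)) (trans (factor l i j k a b c) eq))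
      where
      expand : ∀ i y j δ k a b c → i ℕ.* a ℕ.+ (y ℕ.+ j) ℕ.* b ℕ.+ (δ ℕ.+ k) ℕ.* c ≡
        y ℕ.* b ℕ.+ δ ℕ.* c ℕ.+ (i ℕ.* a ℕ.+ j ℕ.* b ℕ.+ k ℕ.* c)
      expand = ℕ-Solver.solve-∀
      factor : ∀ l i j k a b c → l ℕ.* a ℕ.+ (i ℕ.* a ℕ.+ j ℕ.* b ℕ.+ k ℕ.* c) ≡
        (l ℕ.+ i) ℕ.* a ℕ.+ j ℕ.* b ℕ.+ k ℕ.* c
      factor = ℕ-Solver.solve-∀

    factorization₂ : ∀ {i j k} → IsFactorization a b c m (i , h ℕ.+ j , k) →
      IsFactorization a b c m (w ℕ.+ i , j , θ ℕ.+ k)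
    factorization₂ {i} {j} {k} eq = trans (expand w i j θ k a b c) (trans
      (cong (ℕ._+ (i ℕ.* a ℕ.+ j ℕ.* b ℕ.+ k ℕ.* c)) (sym hb≡wa+θc)) (trans (factor h i j k a b c) eq))
      where
      expand : ∀ w i j θ k a b c → (w ℕ.+ i) ℕ.* a ℕ.+ j ℕ.* b ℕ.+ (θ ℕ.+ k) ℕ.* c ≡
        w ℕ.* a ℕ.+ θ ℕ.* c ℕ.+ (i ℕ.* a ℕ.+ j ℕ.* b ℕ.+ k ℕ.* c)
      expand = ℕ-Solver.solve-∀
      factor : ∀ h i j k a b c → h ℕ.* b ℕ.+ (i ℕ.* a ℕ.+ j ℕ.* b ℕ.+ k ℕ.* c) ≡
        i ℕ.* a ℕ.+ (h ℕ.+ j) ℕ.* b ℕ.+ k ℕ.* c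
      factor = ℕ-Solver.solve-∀

    factorization₁₂ : ∀ {i j k} → IsFactorization a b c m (l ∸ w ℕ.+ i , h ∸ y ℕ.+ j , k) →
      IsFactorization a b c m (i , j , δ ℕ.+ θ ℕ.+ k)
    factorization₁₂ {i} {j} {k} eq = trans (expand i j (δ ℕ.+ θ) k a b c) (trans
      (cong (ℕ._+ (i ℕ.* a ℕ.+ j ℕ.* b ℕ.+ k ℕ.* c)) (sym corner≡))
      (trans (factor (l ∸ w) (h ∸ y) i j k a b c) eq))
      where
      expand : ∀ i j d k a b c → i ℕ.* a ℕ.+ j ℕ.* b ℕ.+ (d ℕ.+ k) ℕ.* c ≡
        d ℕ.* c ℕ.+ (i ℕ.* a ℕ.+ j ℕ.* b ℕ.+ k ℕ.* c)
      expand = ℕ-Solver.solve-∀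
      factor : ∀ e f i j k a b c → e ℕ.* a ℕ.+ f ℕ.* b ℕ.+ (i ℕ.* a ℕ.+ j ℕ.* b ℕ.+ k ℕ.* c) ≡
        (e ℕ.+ i) ℕ.* a ℕ.+ (f ℕ.+ j) ℕ.* b ℕ.+ k ℕ.* c
      factor = ℕ-Solver.solve-∀

    -- Each move towards the L-shape increases the third coordinate, which is at most m.
    factorization-isPoint : ∀ n i j k → m ℕ.< k ℕ.+ n → IsFactorization a b c m (i , j , k) → IsPoint (i , j , k)
    factorization-isPoint zero i j k m<k eq = contradiction
      (ℕ.<-≤-trans m<k (ℕ.≤-trans (ℕ.≤-reflexive (ℕ.+-identityʳ k))
        (ℕ.≤-trans (ℕ.m≤m*n k c) (ℕ.≤-trans (ℕ.m≤n+m _ (i ℕ.* a ℕ.+ j ℕ.* b)) (ℕ.≤-reflexive eq)))))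
      (ℕ.<-irrefl refl)
    factorization-isPoint (suc n) i j k m<k+n eq = go (l ℕ.≤? i) (h ℕ.≤? j) (inCorner? (i , j))
      where
      -- `n` is the fuel: a gain `d > 0` in the third coordinate pays for lowering it by one.
      recurse : ∀ d → 0 ℕ.< d → ∀ i′ j′ → IsFactorization a b c m (i′ , j′ , d ℕ.+ k) → IsPoint (i′ , j′ , d ℕ.+ k)
      recurse d 0<d i′ j′ = factorization-isPoint n i′ j′ (d ℕ.+ k)
        (ℕ.<-≤-trans m<k+n (ℕ.≤-trans (ℕ.≤-reflexive (ℕ.+-suc k n)) (ℕ.+-monoˡ-≤ n (ℕ.+-monoˡ-≤ k 0<d))))
      go : Dec (l ℕ.≤ i) → Dec (h ℕ.≤ j) → Dec (InCorner (i , j)) → IsPoint (i , j , k)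
      go (yes l≤i) _ _ with i′ , refl ← ℕ.m≤n⇒∃[o]m+o≡n l≤i =
        move₁ (recurse δ (ℕ.>-nonZero⁻¹ δ) i′ (y ℕ.+ j) (factorization₁ {i′} {j} {k} eq))
      go (no _) (yes h≤j) _ with j′ , refl ← ℕ.m≤n⇒∃[o]m+o≡n h≤j =
        move₂ (recurse θ (ℕ.>-nonZero⁻¹ θ) (w ℕ.+ i) j′ (factorization₂ {i} {j′} {k} eq))
      go (no _) (no _) (yes (≤i , ≤j))
        with i′ , refl ← ℕ.m≤n⇒∃[o]m+o≡n ≤i | j′ , refl ← ℕ.m≤n⇒∃[o]m+o≡n ≤j =
        move₁₂ (recurse (δ ℕ.+ θ) (ℕ.<-≤-trans (ℕ.>-nonZero⁻¹ δ) (ℕ.m≤m+n δ θ)) i′ j′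
          (factorization₁₂ {i′} {j′} {k} eq))
      -- Inside the rectangle and outside the corner means inside the L-shape, so this is the basic
      -- factorization, with `p = q = 0`.
      go (no l≰i) (no h≰j) (no ∉corner) = 0 , 0 , trans base (cong ι (sym (L-shape-unique
        (∈-filter⁺ (¬? ∘ inCorner?)
          (∈-cartesianProduct⁺ (∈-upTo⁺ (ℕ.≰⇒> l≰i)) (∈-upTo⁺ (ℕ.≰⇒> h≰j))) ∉corner) eq)))
        where
        base : point 0 0 ≡ ι (x₀ , y₀ , z₀)
        base = cong₂ _,_ (zeros (+ x₀)) (cong₂ _,_ (zeros (+ y₀)) (zeros′ (+ z₀)))
          where
          zeros : ∀ i → i + 0ℤ - 0ℤ ≡ i
          zeros = solve-∀
          zeros′ : ∀ i → i - 0ℤ ≡ i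
          zeros′ = solve-∀

    -- `D` makes the coordinates natural numbers. They still represent `m`, since `p` and `q`
    -- multiply `la - yb - δc` and `hb - wa - θc`, which are both zero.
    D⇒factorization : ∀ {p q} → D p q → ∃ λ u → IsFactorization a b c m u × point p q ≡ ι u
    D⇒factorization {p} {q} (qw≤ , py≤ , ≤z₀) = (∣ X ∣ , ∣ Y ∣ , ∣ Z ∣) , +-injective factorization ,
      sym (cong₂ _,_ +∣X∣ (cong₂ _,_ +∣Y∣ +∣Z∣))
      where
      X = proj₁ (point p q)
      Y = proj₁ (proj₂ (point p q))
      Z = proj₂ (proj₂ (point p q))
      +∣X∣ : + ∣ X ∣ ≡ X
      +∣X∣ = 0≤i⇒+∣i∣≡i (i≤j⇒0≤j-i qw≤)
      +∣Y∣ : + ∣ Y ∣ ≡ Y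
      +∣Y∣ = 0≤i⇒+∣i∣≡i (i≤j⇒0≤j-i py≤)
      +∣Z∣ : + ∣ Z ∣ ≡ Z
      +∣Z∣ = 0≤i⇒+∣i∣≡i (i≤j⇒0≤j-i ≤z₀)
      pos-factorization : ∀ i j k →
        + (i ℕ.* a ℕ.+ j ℕ.* b ℕ.+ k ℕ.* c) ≡ + i * + a + + j * + b + + k * + c
      pos-factorization i j k = cong₂ _+_ (cong₂ _+_ (pos-* i a) (pos-* j b)) (pos-* k c)
      factorization : + (∣ X ∣ ℕ.* a ℕ.+ ∣ Y ∣ ℕ.* b ℕ.+ ∣ Z ∣ ℕ.* c) ≡ + m
      factorization = begin
        + (∣ X ∣ ℕ.* a ℕ.+ ∣ Y ∣ ℕ.* b ℕ.+ ∣ Z ∣ ℕ.* c)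
          ≡⟨ pos-factorization (∣ X ∣) (∣ Y ∣) (∣ Z ∣) ⟩
        + ∣ X ∣ * + a + + ∣ Y ∣ * + b + + ∣ Z ∣ * + c
          ≡⟨ cong₂ _+_ (cong₂ (λ i j → i * + a + j * + b) +∣X∣ +∣Y∣) (cong (_* + c) +∣Z∣) ⟩
        X * + a + Y * + b + Z * + c
          ≡⟨ regroup (+ a) (+ b) (+ c) (+ l) (+ h) (+ w) (+ y) (+ δ) (+ θ) (+ x₀) (+ y₀) (+ z₀) (+ p) (+ q) ⟩
        (+ x₀ * + a + + y₀ * + b + + z₀ * + c)
          + (+ p * (+ l * + a - + y * + b - + δ * + c) + + q * (+ h * + b - + w * + a - + θ * + c))
          ≡⟨ cong₂ (λ i j → (+ x₀ * + a + + y₀ * + b + + z₀ * + c) + (+ p * i + + q * j))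
               (i≡j⇒i-j≡0 (sym δc≡)) (i≡j⇒i-j≡0 (sym θc≡)) ⟩
        (+ x₀ * + a + + y₀ * + b + + z₀ * + c) + (+ p * 0ℤ + + q * 0ℤ)
          ≡⟨ zeros (+ x₀ * + a + + y₀ * + b + + z₀ * + c) (+ p) (+ q) ⟩
        + x₀ * + a + + y₀ * + b + + z₀ * + c
          ≡⟨ pos-factorization x₀ y₀ z₀ ⟨
        + (x₀ ℕ.* a ℕ.+ y₀ ℕ.* b ℕ.+ z₀ ℕ.* c)
          ≡⟨ cong +_ Basic.factorization ⟩
        + m ∎
        where
        open ≡-Reasoning
        regroup : ∀ a b c l h w y δ θ x₀ y₀ z₀ p q →
          (x₀ + p * l - q * w) * a + (y₀ + q * h - p * y) * b + (z₀ - (p * δ + q * θ)) * c ≡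
          (x₀ * a + y₀ * b + z₀ * c) + (p * (l * a - y * b - δ * c) + q * (h * b - w * a - θ * c))
        regroup = solve-∀
        zeros : ∀ i p q → i + (p * 0ℤ + q * 0ℤ) ≡ i
        zeros = solve-∀

    point≡ι⇒D : ∀ {p q u} → point p q ≡ ι u → D p q
    point≡ι⇒D {u = i , j , k} eq =
      0≤i-j⇒j≤i (subst (0ℤ ≤_) (sym (cong proj₁ eq)) (nonNeg i)) ,
      0≤i-j⇒j≤i (subst (0ℤ ≤_) (sym (cong (proj₁ ∘ proj₂) eq)) (nonNeg j)) ,
      0≤i-j⇒j≤i (subst (0ℤ ≤_) (sym (cong (proj₂ ∘ proj₂) eq)) (nonNeg k))

    -- Both lists are compared in ℤ³, where `point` takes its values; injectivity of `ι` and `point`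
    -- keeps them free of repetitions.
    denumerant≡length-staircase : ∀ {n α β} → IsStaircase D n α β →
      denumerant a b c m ≡ length (staircase α β n)
    denumerant≡length-staircase {n} {α} {β} D-staircase = begin
      denumerant a b c m
        ≡⟨ length-map ι (factorizations a b c m) ⟨
      length (map ι (factorizations a b c m))
        ≡⟨ length-unique (Unique.map⁺ ι-injective (factorizations-unique a b c m))
             (Unique.map⁺ point-injective (staircase-unique α β n)) ⊆ ⊇ ⟩
      length (map (uncurry point) (staircase α β n))
        ≡⟨ length-map (uncurry point) (staircase α β n) ⟩
      length (staircase α β n) ∎
      where
      open ≡-Reasoning
      open Equivalence
      ⊆ : ∀ {v} → v ∈ˡ map ι (factorizations a b c m) → v ∈ˡ map (uncurry point) (staircase α β n)
      ⊆ v∈ with ∈-map⁻ ι v∈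
      ... | (i , j , k) , u∈ , refl with factorization-isPoint (suc m) i j k (ℕ.m≤n+m (suc m) k)
                                           (to (∈-factorizations a b c m (i , j , k)) u∈)
      ...   | p , q , eq = subst (_∈ˡ map (uncurry point) (staircase α β n)) eq
        (∈-map⁺ (uncurry point) (∈-staircase⁺ D-staircase p q (point≡ι⇒D {p} {q} eq)))
      ⊇ : ∀ {v} → v ∈ˡ map (uncurry point) (staircase α β n) → v ∈ˡ map ι (factorizations a b c m)
      ⊇ v∈ with ∈-map⁻ (uncurry point) v∈
      ... | (p , q) , pq∈ , refl with D⇒factorization {p} {q} (∈-staircase⁻ D-staircase pq∈)
      ...   | u , u-factorization , eq = subst (_∈ˡ map ι (factorizations a b c m)) (sym eq)
        (∈-map⁺ ι (from (∈-factorizations a b c m u) u-factorization))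

    -- Assembling the diagonal and the two sides

    A : ℕ
    A = (z₀ ℕ./ (δ ℕ.+ θ)) {{ℕ.>-nonZero (ℕ.<-≤-trans (ℕ.>-nonZero⁻¹ δ) (ℕ.m≤m+n δ θ))}}

    ≤z₀⇔≤A : ∀ k → + k * (+ δ + + θ) ≤ + z₀ ⇔ k ℕ.< suc A
    ≤z₀⇔≤A k = ⇔-trans (*n≤⇔≤⌊/n⌋ (+ k) (+ z₀) (δ ℕ.+ θ))
      (mk⇔ (ℕ.s≤s ∘ drop‿+≤+) (+≤+ ∘ ℕ.s≤s⁻¹))
      where instance δ+θ-nonZero = ℕ.>-nonZero (ℕ.<-≤-trans (ℕ.>-nonZero⁻¹ δ) (ℕ.m≤m+n δ θ))

    module Lower = Side a h y y₀ z₀ δ θ A a≡hδ+yθ (ℕ.<⇒≤ y<h) (proj₂ basic∈rectangle) ≤z₀⇔≤A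
    module Upper = Side b l w x₀ z₀ θ δ A b≡lθ+wδ (ℕ.<⇒≤ w<l) (proj₁ basic∈rectangle)
      (λ k → subst (λ i → + k * i ≤ + z₀ ⇔ k ℕ.< suc A) (+-comm (+ δ) (+ θ)) (≤z₀⇔≤A k))

    -- The chain `qw ≤ pw ≤ pl` shows that the first coordinate can become negative only above the
    -- diagonal.
    q≤p⇒qw≤x₀+pl : ∀ {p q} → q ℕ.≤ p → + q * + w ≤ + x₀ + + p * + l
    q≤p⇒qw≤x₀+pl {p} {q} q≤p = ≤-trans (*-monoʳ-≤-nonNeg (+ w) (+≤+ q≤p))
      (≤-trans (*-monoˡ-≤-nonNeg (+ p) (+≤+ (ℕ.<⇒≤ w<l)))
        (subst (_≤ + x₀ + + p * + l) (+-identityˡ _) (+-monoˡ-≤ (+ p * + l) (nonNeg x₀))))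

    p≤q⇒py≤y₀+qh : ∀ {p q} → p ℕ.≤ q → + p * + y ≤ + y₀ + + q * + h
    p≤q⇒py≤y₀+qh {p} {q} p≤q = ≤-trans (*-monoʳ-≤-nonNeg (+ y) (+≤+ p≤q))
      (≤-trans (*-monoˡ-≤-nonNeg (+ q) (+≤+ (ℕ.<⇒≤ y<h)))
        (subst (_≤ + y₀ + + q * + h) (+-identityˡ _) (+-monoˡ-≤ (+ q * + h) (nonNeg y₀))))

    D-isStaircase : ∀ {α β} → Lower.RowLengths α → Upper.RowLengths β → IsStaircase D (suc A) α β
    D-isStaircase {α} {β} α-rows β-rows = record
      { diagonal = λ k → ⇔-trans (mk⇔
          (λ (_ , _ , ≤z₀) → subst (_≤ + z₀) (sym (*-distribˡ-+ (+ k) (+ δ) (+ θ))) ≤z₀)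
          (λ ≤z₀ → q≤p⇒qw≤x₀+pl {k} ℕ.≤-refl , p≤q⇒py≤y₀+qh {k} ℕ.≤-refl ,
            subst (_≤ + z₀) (*-distribˡ-+ (+ k) (+ δ) (+ θ)) ≤z₀)) (≤z₀⇔≤A k)
      ; lower = λ k j → ⇔-trans (mk⇔ proj₂
          (λ (py≤ , ≤z₀) → q≤p⇒qw≤x₀+pl {suc (k ℕ.+ j)} {k} (k≤ k j) , py≤ , ≤z₀)) (α-rows k j)
      ; upper = λ k j → ⇔-trans (mk⇔
          (λ (qw≤ , _ , ≤z₀) → qw≤ , subst (_≤ + z₀) (+-comm (+ k * + δ) (+ suc (k ℕ.+ j) * + θ)) ≤z₀)
          (λ (qw≤ , ≤z₀) → qw≤ , p≤q⇒py≤y₀+qh {k} {suc (k ℕ.+ j)} (k≤ k j) ,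
            subst (_≤ + z₀) (+-comm (+ suc (k ℕ.+ j) * + θ) (+ k * + δ)) ≤z₀)) (β-rows k j)
      }
      where
      k≤ : ∀ k j → k ℕ.≤ suc (k ℕ.+ j)
      k≤ k j = ℕ.m≤n⇒m≤1+n (ℕ.m≤m+n k j)

    denumerant-sum : ∀ {σ τ} →
      (∃ λ α → Lower.RowLengths α × sumBelow (suc A) (λ k → + α k) ≡ σ) →
      (∃ λ β → Upper.RowLengths β × sumBelow (suc A) (λ k → + β k) ≡ τ) →
      + denumerant a b c m ≡ 1ℤ + + A + σ + τ
    denumerant-sum (α , α-rows , refl) (β , β-rows , refl) =
      trans (cong +_ (denumerant≡length-staircase (D-isStaircase α-rows β-rows))) (length-staircase α β (suc A))

-- The formulas case by case

theorem7 :
    (a b c : ℕ) .{{_ : NonZero a}} .{{_ : NonZero b}} .{{_ : NonZero c}} →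
    a ℕ.< b → b ℕ.< c → gcd (gcd a b) c ≡ 1 →
    (l h w y : ℕ) → w ℕ.< l → y ℕ.< h → IsRelated a b c (LShape l h w y) →
    (δ θ : ℕ) .{{_ : NonZero δ}} .{{_ : NonZero θ}} →
    + δ * + c ≡ + l * + a - + y * + b →
    + θ * + c ≡ + h * + b - + w * + a →
    (m : ℕ) → m ∈ ⟨ a , b , c ⟩ →
    (x₀ y₀ z₀ : ℕ) → IsBasicFactorization a b c (LShape l h w y) m x₀ y₀ z₀ →
    let open Formulas a b l h w y δ θ x₀ y₀ z₀
        d : ℤ
        d = + denumerant a b c m
        formula₁ : ℤ
        formula₁ = (1ℤ + Aₘ) * (1ℤ + ⌊z₀/δ⌋ + ⌊z₀/θ⌋)
                 - (⌊δ/θ⌋ + ⌊θ/δ⌋ + + 2) * ⌊ Aₘ * (1ℤ + Aₘ) / 2 ⌋ + Σ₁ + Σ₂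
    in
    (.{{_ : NonZero w}} → 0ℤ ≤ k₀)
    × (.{{_ : NonZero y}} → 0ℤ ≤ k₁)
    × (w ≡ 0 → y ≡ 0 → d ≡ formula₁)
    × (.{{_ : NonZero w}} → y ≡ 0 →
        (k₀ ≡ 0ℤ → d ≡ formula₁)
        × (0ℤ < k₀ → d ≡ (1ℤ + Aₘ) * (1ℤ + ⌊z₀/δ⌋)
                        - (1ℤ + ⌊θ/δ⌋) * ⌊ Aₘ * (1ℤ + Aₘ) / 2 ⌋ + Σ₁ + 𝓑))
    × (w ≡ 0 → .{{_ : NonZero y}} →
        (k₁ ≡ 0ℤ → d ≡ formula₁)
        × (0ℤ < k₁ → d ≡ (1ℤ + Aₘ) * (1ℤ + ⌊z₀/θ⌋)
                        - (⌊δ/θ⌋ + 1ℤ) * ⌊ Aₘ * (1ℤ + Aₘ) / 2 ⌋ + Σ₂ + 𝓐))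
    × (.{{_ : NonZero w}} → .{{_ : NonZero y}} → d ≡ 1ℤ + Aₘ + 𝓐 + 𝓑)
theorem7 a b c _ _ _ l h w y w<l y<h related δ θ δc≡ θc≡ m _ x₀ y₀ z₀ basic =
  Upper.0≤k₁ , Lower.0≤k₁ ,
  -- `y = 0` makes the lower side contribute `𝓐₀` and `w = 0` makes the upper side contribute `𝓑₀`;
  -- nonzero values give `𝓐` and `𝓑`.
  (λ w≡0 y≡0 → trans (sum (Lower.rowLengths-0 y≡0) (Upper.rowLengths-0 w≡0)) no-threshold) ,
  (λ y≡0 →
    (λ k₀≡0 → trans (sum (Lower.rowLengths-0 y≡0) upper)
      (trans (cong (_+_ (1ℤ + Aₘ + 𝓐₀)) (𝓑≡𝓑₀ k₀≡0)) no-threshold)) ,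
    λ _ → trans (sum (Lower.rowLengths-0 y≡0) upper) (upper-threshold Aₘ ⌊z₀/δ⌋ ⌊θ/δ⌋ T Σ₁ 𝓑)) ,
  (λ w≡0 →
    (λ k₁≡0 → trans (sum lower (Upper.rowLengths-0 w≡0))
      (trans (cong (λ σ → 1ℤ + Aₘ + σ + 𝓑₀) (𝓐≡𝓐₀ k₁≡0)) no-threshold)) ,
    λ _ → trans (sum lower (Upper.rowLengths-0 w≡0)) (lower-threshold Aₘ ⌊z₀/θ⌋ ⌊δ/θ⌋ T Σ₂ 𝓐)) ,
  sum lower upper
  where
  open Formulas a b l h w y δ θ x₀ y₀ z₀
  open Counting a b c l h w y w<l y<h related δ θ δc≡ θc≡
  open Enumeration m x₀ y₀ z₀ basic
    using (module Lower; module Upper) renaming (denumerant-sum to sum)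
  T = ⌊ Aₘ * (1ℤ + Aₘ) / 2 ⌋
  lower : .{{_ : NonZero y}} → _
  lower = Lower.rowLengths-+ (⌊θ/δ⌋ + ⌊h/y⌋) refl
  upper : .{{_ : NonZero w}} → _
  upper = Upper.rowLengths-+ (⌊l/w⌋ + ⌊δ/θ⌋) (+-comm ⌊l/w⌋ ⌊δ/θ⌋)
  𝓐≡𝓐₀ : .{{_ : NonZero y}} → k₁ ≡ 0ℤ → 𝓐 ≡ 𝓐₀
  𝓐≡𝓐₀ k₁≡0 = cong (if_then 𝓐₀ else if does (k₁ ≤? Aₘ) then 𝓐₁ else 𝓐₂) (dec-true (k₁ ≟ 0ℤ) k₁≡0)
  𝓑≡𝓑₀ : .{{_ : NonZero w}} → k₀ ≡ 0ℤ → 𝓑 ≡ 𝓑₀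
  𝓑≡𝓑₀ k₀≡0 = cong (if_then 𝓑₀ else if does (k₀ ≤? Aₘ) then 𝓑₁ else 𝓑₂) (dec-true (k₀ ≟ 0ℤ) k₀≡0)
  -- Shared by the case `w = y = 0` and by the subcases `k₀ = 0` and `k₁ = 0`, where both sides
  -- reduce to their sums without a threshold.
  no-threshold : 1ℤ + Aₘ + 𝓐₀ + 𝓑₀ ≡ (1ℤ + Aₘ) * (1ℤ + ⌊z₀/δ⌋ + ⌊z₀/θ⌋)
    - (⌊δ/θ⌋ + ⌊θ/δ⌋ + + 2) * T + Σ₁ + Σ₂
  no-threshold = regroup Aₘ ⌊z₀/δ⌋ ⌊z₀/θ⌋ ⌊δ/θ⌋ ⌊θ/δ⌋ T Σ₁ Σ₂
    where
    regroup : ∀ A z₁ z₂ δ̄ θ̄ T Σ₁ Σ₂ →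
      1ℤ + A + ((1ℤ + A) * z₁ - (θ̄ + 1ℤ) * T + Σ₁) + ((1ℤ + A) * z₂ - (δ̄ + 1ℤ) * T + Σ₂) ≡
      (1ℤ + A) * (1ℤ + z₁ + z₂) - (δ̄ + θ̄ + + 2) * T + Σ₁ + Σ₂
    regroup = solve-∀
  upper-threshold : ∀ A z₁ θ̄ T Σ₁ τ → 1ℤ + A + ((1ℤ + A) * z₁ - (θ̄ + 1ℤ) * T + Σ₁) + τ ≡
    (1ℤ + A) * (1ℤ + z₁) - (1ℤ + θ̄) * T + Σ₁ + τ
  upper-threshold = solve-∀
  lower-threshold : ∀ A z₂ δ̄ T Σ₂ σ → 1ℤ + A + σ + ((1ℤ + A) * z₂ - (δ̄ + 1ℤ) * T + Σ₂) ≡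
    (1ℤ + A) * (1ℤ + z₂) - (δ̄ + 1ℤ) * T + Σ₂ + σ
  lower-threshold = solve-∀
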